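{- For $n\geq1$, $$T_{n+1}^E(x)=nxT_n^E(x)+2x(1-x)\frac{d}{dx}T_n^E(x)+xT_n^O(x),$$ $$T_{n+1}^O(x)=((n-1)x+1)T_n^O(x)+2x(1-x)\frac{d}{dx}T_n^O(x)+T_n^E(x),$$ with $T_1^E(x)=0$ and $T_1^O(x)=1$. Moreover, both $T_n^E(x)$ and $T_n^O(x)$ have only real negative zeros and $T_n^O(x)\prec T_n^E(x)$.
   Context: $\mathcal{S}_n$ is the symmetric group on $[n]$, $\pi=\pi(1)\cdots\pi(n)$, with the convention $\pi(0)=0$. The left peak number is ${\rm lpk}(\pi)=\#\{i\in[n-1]:\pi(i-1)<\pi(i)>\pi(i+1)\}$. Let $\mathcal{S}_n^+=\{\pi\in\mathcal{S}_n:\pi(n-1)>\pi(n)\}$, $\mathcal{S}_n^-=\{\pi\in\mathcal{S}_n:\pi(n-1)<\pi(n)\}$, $T_n^E(x)=\sum_{\pi\in\mathcal{S}_n^+}x^{{\rm lpk}(\pi)}$, $T_n^O(x)=\sum_{\pi\in\mathcal{S}_n^- }x^{{\rm lpk}(\pi)}$. For real-rooted polynomials $p,q$ with zeros $\xi_1\le\cdots\le\xi_n$ and $\theta_1\le\cdots\le\theta_m$, $p\prec q$ means either $\deg q=\deg p+1$ and $\theta_1\le\xi_1\le\theta_2\le\cdots\le\xi_n\le\theta_{n+1}$, or $\deg p=\deg q$ and $\xi_1\le\theta_1\le\xi_2\le\cdots\le\xi_n\le\theta_n$.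
   Formalization: "Negative zeros" is read as non-positive, since T_n^E(0)=0 for n≥2 (e.g. T_2^E=x); the claims on zeros and interlacing are stated for n≥2, since T_1^E=0 is the zero polynomial. -}

module Defs where

open import Data.Bool using (Bool; true; false; _∧_)
open import Data.Nat as ℕ using (ℕ; zero; suc; _<ᵇ_; _≡ᵇ_; _∸_)
open import Data.Integer as ℤ using (ℤ; +_; -[1+_])
open import Data.List using (List; []; _∷_; map; concatMap; filterᵇ; length; upTo; foldr)
open import Data.List.Relation.Unary.All using (All)
open import Data.List.Relation.Unary.Linked using (Linked)
open import Data.Product using (Σ; ∃; _×_; _,_)
open import Data.Sum using (_⊎_)
open import Relation.Binary.PropositionalEquality using (_≡_; _≢_)
open import Relation.Binary.Structures using (IsStrictTotalOrder)
open import Algebra.Structures using (IsCommutativeRing)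

-- Permutations of [n] as lists (one-line notation), enumerated by
-- inserting n into every position of every permutation of [n-1].

insertions : ℕ → List ℕ → List (List ℕ)
insertions x [] = (x ∷ []) ∷ []
insertions x (y ∷ ys) = (x ∷ y ∷ ys) ∷ map (y ∷_) (insertions x ys)

perms : ℕ → List (List ℕ)
perms zero = [] ∷ []
perms (suc n) = concatMap (insertions (suc n)) (perms n)

-- left peak number, with the convention π(0) = 0
lpkAux : ℕ → List ℕ → ℕ
lpkAux p (a ∷ b ∷ r) = (if′ ((p <ᵇ a) ∧ (b <ᵇ a))) ℕ.+ lpkAux a (b ∷ r)
  where
  if′ : Bool → ℕ
  if′ true = 1
  if′ false = 0
lpkAux p _ = 0

lpk : List ℕ → ℕ
lpk π = lpkAux 0 π

-- π(n-1) > π(n), with π(0) = 0  (membership in S_n^+)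
plusAux : ℕ → List ℕ → Bool
plusAux p [] = false
plusAux p (a ∷ []) = a <ᵇ p
plusAux p (a ∷ b ∷ r) = plusAux a (b ∷ r)

isPlus : List ℕ → Bool
isPlus π = plusAux 0 π

not : Bool → Bool
not true = false
not false = true

-- Polynomials with integer coefficients as coefficient lists
-- (constant term first); equality is coefficientwise.

Poly : Set
Poly = List ℤ

coeff : Poly → ℕ → ℤ
coeff [] k = + 0
coeff (a ∷ p) zero = a
coeff (a ∷ p) (suc k) = coeff p k

_≈ₚ_ : Poly → Poly → Set
p ≈ₚ q = ∀ k → coeff p k ≡ coeff q k

_⊕_ : Poly → Poly → Poly
[] ⊕ q = q
(a ∷ p) ⊕ [] = a ∷ p
(a ∷ p) ⊕ (b ∷ q) = (a ℤ.+ b) ∷ (p ⊕ q)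

scale : ℤ → Poly → Poly
scale c p = map (c ℤ.*_) p

mulX : Poly → Poly
mulX p = + 0 ∷ p

mul1mX : Poly → Poly
mul1mX p = p ⊕ scale -[1+ 0 ] (mulX p)

derivAux : ℕ → Poly → Poly
derivAux k [] = []
derivAux k (a ∷ p) = (+ k ℤ.* a) ∷ derivAux (suc k) p

deriv : Poly → Poly
deriv [] = []
deriv (a ∷ p) = derivAux 1 p

-- T_n^E and T_n^O: coefficient of x^k counts permutations with lpk = k
-- (lpk π ≤ n, so coefficients up to x^n suffice).

countLpk : (List ℕ → Bool) → ℕ → ℕ → ℤ
countLpk side n k = + length (filterᵇ (λ π → side π ∧ (lpk π ≡ᵇ k)) (perms n))

TE : ℕ → Poly
TE n = map (countLpk isPlus n) (upTo (suc n))

TO : ℕ → Poly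
TO n = map (countLpk (λ π → not (isPlus π)) n) (upTo (suc n))

RHS-E : ℕ → Poly
RHS-E n = scale (+ n) (mulX (TE n))
        ⊕ (scale (+ 2) (mulX (mul1mX (deriv (TE n))))
        ⊕ mulX (TO n))

RHS-O : ℕ → Poly
RHS-O n = (scale (+ (n ∸ 1)) (mulX (TO n)) ⊕ TO n)
        ⊕ (scale (+ 2) (mulX (mul1mX (deriv (TO n))))
        ⊕ TE n)

-- The real numbers, axiomatised as a Dedekind-complete ordered field
-- (unique up to isomorphism).

record RealField : Set₁ where
  infixl 6 _+_
  infixl 7 _*_
  infix 4 _<_ _≤_
  field
    Carrier : Set
    _+_ _*_ : Carrier → Carrier → Carrier
    -_ : Carrier → Carrier
    0# 1# : Carrier
    isCommutativeRing : IsCommutativeRing _≡_ _+_ _*_ -_ 0# 1#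
    _<_ : Carrier → Carrier → Set
    isStrictTotalOrder : IsStrictTotalOrder _≡_ _<_
    inverse : ∀ x → x ≢ 0# → Σ Carrier (λ y → x * y ≡ 1#)
    0<1 : 0# < 1#
    +-mono-< : ∀ {x y} z → x < y → x + z < y + z
    *-pos : ∀ {x y} → 0# < x → 0# < y → 0# < x * y

  _≤_ : Carrier → Carrier → Set
  x ≤ y = x < y ⊎ x ≡ y

  field
    sup : (P : Carrier → Set) → Σ Carrier P →
          Σ Carrier (λ b → ∀ x → P x → x ≤ b) →
          Σ Carrier (λ s → (∀ x → P x → x ≤ s) ×
                           (∀ b → (∀ x → P x → x ≤ b) → s ≤ b))

module _ (R : RealField) where
  open RealField R

  _-_ : Carrier → Carrier → Carrier
  x - y = x + (- y)

  fromℕ : ℕ → Carrier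
  fromℕ zero = 0#
  fromℕ (suc n) = 1# + fromℕ n

  fromℤ : ℤ → Carrier
  fromℤ (+ n) = fromℕ n
  fromℤ -[1+ n ] = - fromℕ (suc n)

  eval : Poly → Carrier → Carrier
  eval [] x = 0#
  eval (a ∷ p) x = fromℤ a + x * eval p x

  prod : List Carrier → Carrier
  prod = foldr _*_ 1#

  Sorted : List Carrier → Set
  Sorted = Linked _≤_

  -- ξ is the sorted list of all zeros (with multiplicity) of p, and p
  -- splits over ℝ:  p(x) = c ∏ (x - ξᵢ) with c ≠ 0
  ZerosOf : Poly → List Carrier → Set
  ZerosOf p ξ = Sorted ξ ×
    Σ Carrier (λ c → c ≢ 0# × (∀ x → eval p x ≡ c * prod (map (λ r → x - r) ξ)))

  OnlyRealNonPosZeros : Poly → Set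
  OnlyRealNonPosZeros p = Σ (List Carrier) (λ ξ → ZerosOf p ξ × All (_≤ 0#) ξ)

  interleave : List Carrier → List Carrier → List Carrier
  interleave [] bs = bs
  interleave (a ∷ as) bs = a ∷ interleave bs as

  Interlaces : Poly → Poly → Set
  Interlaces p q = Σ (List Carrier) λ ξ → Σ (List Carrier) λ θ →
    ZerosOf p ξ × ZerosOf q θ ×
    ((length θ ≡ suc (length ξ) × Sorted (interleave θ ξ)) ⊎
     (length ξ ≡ length θ × Sorted (interleave ξ θ)))

{-# OPTIONS --safe #-}
-- Inserting n + 1 in a permutation of [n] creates a left peak, except next to an existing
-- peak (which it replaces) and at the end; counting these positions gives the recurrences.
--
-- For the zeros, suppose the zeros of E = T_n^E are simple, the largest being 0, and that
-- O = T_n^O alternates in sign on them, O(0) > 0.  The next polynomials are E⁺ = x B with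
-- B = n E + 2 (1 − x) E′ + O, and O⁺.  Since E′ and O have the same sign at each zero of E,
-- so has B, which yields a zero of B between any two consecutive ones (and one below all of
-- them when the degree grows).  Where B = 0,
--   O⁺ E = E² + (1 − x) W − x O²,   W = O E + 2 x (O′ E − O E′),
-- and W ≥ 0 for x ≤ 0 by partial fractions of O / E.  So O⁺ has there the sign of E, hence
-- alternates on the zeros of E⁺, and the induction goes on.  The alternation of O on the
-- zeros of E finally locates the zeros of O.
module Submission where

open import Defs hiding (_-_)
open import Algebra.Bundles using (CommutativeRing)
open import Algebra.Solver.Ring.AlmostCommutativeRing using (AlmostCommutativeRing; fromCommutativeRing; _-Raw-AlmostCommutative⟶_)
import Algebra.Properties.Ring
import Algebra.Solver.Ring
open import Data.Bool using (Bool; true; false; _∧_; T)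
open import Data.Bool.Properties using (∧-zeroʳ; ∧-comm)
open import Data.Empty using (⊥-elim)
open import Data.Integer as ℤ using (ℤ)
import Data.Integer.Properties as ℤ
open import Data.Integer.Tactic.RingSolver using () renaming (solve-∀ to ℤ-solve-∀)
open import Data.List using (List; []; _∷_; map; concatMap; filterᵇ; length; applyUpTo; _++_)
open import Data.List.Properties using (map-++)
open import Data.List.Relation.Unary.All as All using (All; []; _∷_)
open import Data.List.Relation.Unary.All.Properties using (concat⁺; map⁺)
open import Data.List.Relation.Unary.AllPairs using (AllPairs; []; _∷_)
open import Data.List.Relation.Unary.Linked as Linked using ([-]; _∷_)
open import Data.Maybe using (Maybe; just; nothing)
open import Data.Nat as ℕ using (ℕ; zero; suc)
import Data.Nat.Properties as ℕ
open import Data.Nat.ListAction using (sum)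
open import Data.Nat.ListAction.Properties using (sum-++)
open import Data.Nat.Tactic.RingSolver using (solve-∀)
open import Data.Product using (Σ; _×_; _,_; proj₁; proj₂)
open import Data.Sum using (_⊎_; inj₁; inj₂)
open import Data.Unit using (⊤; tt)
open import Function using (_∘_; case_of_)
open import Relation.Binary using (tri<; tri≈; tri>)
open import Relation.Binary.PropositionalEquality
open import Relation.Binary.Structures using (IsStrictTotalOrder)
open import Relation.Nullary using (¬_; yes; no)

-- The obstacle is the term with O′ in the recurrence for O⁺: interlacing says nothing of its sign
-- at a zero of E⁺. Multiplying that recurrence by E and subtracting O times the recurrence for E⁺
-- removes the factor n and leaves O′ only inside O′ E - O E′; this is the origin of W. With Q = O /
-- E, W = E² (Q + 2 x Q′) is linear in Q, so the poles of Q can be treated one at a time. Sign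
-- changes bound the number of zeros only from below. That no zero is missed and all are simple
-- rests on the exact degrees, ⌊n/2⌋ for E and ⌊(n - 1)/2⌋ for O, which come from counting:
-- coefficients beyond vanish, the top ones are positive. The parity of n thus decides whether a
-- further zero, found from the sign at -∞, lies below the others. The reals are given only as an
-- ordered field with suprema, hence the intermediate value theorem is derived here, for polynomial
-- functions.

module Recurrences where
  open import Data.Nat using (_+_; _*_; _≤_; _<_; _<ᵇ_; _≡ᵇ_; z≤n; s≤s; s≤s⁻¹; >-nonZero)
  open import Data.Nat.Properties

  -- Left peaks and side of a word.

  𝟙 : Bool → ℕ
  𝟙 true = 1
  𝟙 false = 0

  Perm : ℕ → List ℕ → Set
  Perm n π = length π ≡ n × All (_≤ n) π

  insertions-Perm : ∀ x {m} ys → length ys ≡ m → All (_≤ x) ys →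
    All (λ zs → length zs ≡ suc m × All (_≤ x) zs) (insertions x ys)
  insertions-Perm x [] refl [] = (refl , ≤-refl ∷ []) ∷ []
  insertions-Perm x (y ∷ ys) refl (y≤x ∷ ys≤x) =
    (refl , ≤-refl ∷ y≤x ∷ ys≤x) ∷
    map⁺ (All.map (λ (l , a) → cong suc l , y≤x ∷ a) (insertions-Perm x ys refl ys≤x))

  perms-Perm : ∀ n → All (Perm n) (perms n)
  perms-Perm zero = (refl , []) ∷ []
  perms-Perm (suc n) = concat⁺ (map⁺
    (All.map (λ {π} (l , a) → insertions-Perm (suc n) π l (All.map m≤n⇒m≤1+n a)) (perms-Perm n)))

  -- The weight `φ` is arbitrary, so that one count of insertions serves E and O at every
  -- coefficient; `p` is the letter before the word, 0 for a whole permutation.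
  Σstat : ℕ → (Bool → ℕ → ℕ) → List (List ℕ) → ℕ
  Σstat p φ L = sum (map (λ π → φ (plusAux p π) (lpkAux p π)) L)

  peak : ℕ → ℕ → ℕ → Bool
  peak p a b = (p <ᵇ a) ∧ (b <ᵇ a)

  lpkAux-∷ : ∀ p a b r → lpkAux p (a ∷ b ∷ r) ≡ 𝟙 (peak p a b) + lpkAux a (b ∷ r)
  lpkAux-∷ p a b r with peak p a b
  ... | true = refl
  ... | false = refl

  <⇒<ᵇ≡true : ∀ {m n} → m < n → (m <ᵇ n) ≡ true
  <⇒<ᵇ≡true {m} {n} m<n with m <ᵇ n in eq
  ... | true = refl
  ... | false = ⊥-elim (subst T eq (<⇒<ᵇ m<n))

  ≤⇒<ᵇ≡false : ∀ {m n} → n ≤ m → (m <ᵇ n) ≡ false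
  ≤⇒<ᵇ≡false {m} {n} n≤m with m <ᵇ n in eq
  ... | false = refl
  ... | true = ⊥-elim (<⇒≱ (<ᵇ⇒< m n (subst T (sym eq) tt)) n≤m)

  -- The value of Σstat on all ways of inserting a new maximum in a word with side P
  -- and left peak number l: s insertions keep l and q increase it, side unchanged;
  -- the insertion at the end, and for P = false the one before the last letter, are separate.
  outcome : Bool → (s q l : ℕ) → (Bool → ℕ → ℕ) → ℕ
  outcome true  s q l φ = s * φ true l + q * φ true (suc l) + φ false l
  outcome false s q l φ = s * φ false l + q * φ false (suc l) + φ true (suc l) + φ false l

  outcome-keep : ∀ P s q l φ → φ P l + outcome P s q l φ ≡ outcome P (suc s) q l φ
  outcome-keep true  s q l φ = ring (s * φ true l) (q * φ true (suc l)) (φ true l) (φ false l)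
    where
    ring : ∀ x y a b → a + (x + y + b) ≡ a + x + y + b
    ring = solve-∀
  outcome-keep false s q l φ =
    ring (s * φ false l) (q * φ false (suc l)) (φ false l) (φ true (suc l))
    where
    ring : ∀ x y a b → a + (x + y + b + a) ≡ a + x + y + b + a
    ring = solve-∀

  outcome-raise : ∀ P s q l φ → φ P (suc l) + outcome P s q l φ ≡ outcome P s (suc q) l φ
  outcome-raise true  s q l φ = ring (s * φ true l) (q * φ true (suc l)) (φ true (suc l)) (φ false l)
    where
    ring : ∀ x y a b → a + (x + y + b) ≡ x + (a + y) + b
    ring = solve-∀
  outcome-raise false s q l φ =
    ring (s * φ false l) (q * φ false (suc l)) (φ false (suc l)) (φ true (suc l)) (φ false l)
    where
    ring : ∀ x y a b c → a + (x + y + b + c) ≡ x + (a + y) + b + c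
    ring = solve-∀

  outcome-shift : ∀ P s q l φ → outcome P s q l (λ P m → φ P (suc m)) ≡ outcome P s q (suc l) φ
  outcome-shift true  s q l φ = refl
  outcome-shift false s q l φ = refl

  ¬both-peaks : ∀ p y b c → peak p y b ≡ true → peak y b c ≡ false
  ¬both-peaks p y b c eq with p <ᵇ y | b <ᵇ y in b<y
  ... | true | true rewrite ≤⇒<ᵇ≡false {y} {b} (<⇒≤ (<ᵇ⇒< b y (subst T (sym b<y) tt))) = refl

  raised : Bool → Bool → ℕ
  raised k k′ = 𝟙 (not k ∧ not k′)

  -- Inserting in front of a letter that is a peak (k′), or right after one (k),
  -- replaces that peak; otherwise it creates a new one.
  front-outcome : ∀ P l q φ k k′ → (k ≡ true → k′ ≡ false) →
    φ P (suc l) + outcome P (𝟙 k′ + 2 * l) q (𝟙 k′ + l) (λ P m → φ P (𝟙 k + m))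
      ≡ outcome P (𝟙 k + 2 * (𝟙 k′ + l)) (raised k k′ + q) (𝟙 k + (𝟙 k′ + l)) φ
  front-outcome P l q φ true true ¬kk with () ← ¬kk refl
  front-outcome P l q φ true false ¬kk =
    trans (cong (φ P (suc l) +_) (outcome-shift P (2 * l) q l φ)) (outcome-keep P (2 * l) q (suc l) φ)
  front-outcome P l q φ false true ¬kk =
    trans (outcome-keep P (1 + 2 * l) q (suc l) φ)
      (cong (λ s → outcome P s q (suc l) φ) (sym (*-suc 2 l)))
  front-outcome P l q φ false false ¬kk = outcome-raise P (2 * l) q l φ

  -- Bookkeeping for `front-outcome`: one more letter means one more slot. The number of slots
  -- finally determines `q`, and n enters the recurrences through it.
  front-total : ∀ k k′ l q e → (k ≡ true → k′ ≡ false) →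
    raised k k′ + q + (𝟙 k + 2 * (𝟙 k′ + l)) + e ≡ suc (q + (𝟙 k′ + 2 * l) + e)
  front-total true  true  l q e ¬kk with () ← ¬kk refl
  front-total true  false = λ l q e _ → ring l q e
    where
    ring : ∀ l q e → q + suc (2 * l) + e ≡ suc (q + 2 * l + e)
    ring = solve-∀
  front-total false true  = λ l q e _ → ring l q e
    where
    ring : ∀ l q e → q + 2 * (suc l) + e ≡ suc (q + suc (2 * l) + e)
    ring = solve-∀
  front-total false false l q e _ = refl

  -- Inserting a maximum into a word of smaller letters.

  module _ (N : ℕ) where

    lpkAux-after-max : ∀ a b r → a < N → lpkAux N (a ∷ b ∷ r) ≡ lpkAux a (b ∷ r)
    lpkAux-after-max a b r a<N rewrite lpkAux-∷ N a b r | ≤⇒<ᵇ≡false (<⇒≤ a<N) = refl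

    lpkAux-at-max : ∀ p a r → p < N → a < N → lpkAux p (N ∷ a ∷ r) ≡ suc (lpkAux N (a ∷ r))
    lpkAux-at-max p a r p<N a<N
      rewrite lpkAux-∷ p N a r | <⇒<ᵇ≡true p<N | <⇒<ᵇ≡true a<N = refl

    lpkAux-before-max : ∀ p a r → a < N → lpkAux p (a ∷ N ∷ r) ≡ lpkAux a (N ∷ r)
    lpkAux-before-max p a r a<N
      rewrite lpkAux-∷ p a N r | ≤⇒<ᵇ≡false (<⇒≤ a<N) | ∧-zeroʳ (p <ᵇ a) = refl

    Inserted : ℕ → ℕ → List ℕ → (Bool → ℕ → ℕ) → ℕ
    Inserted p y r φ = Σstat p φ (map (y ∷_) (insertions N r))

    Inserted-[] : ∀ p y φ → y < N → Inserted p y [] φ ≡ φ false 0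
    Inserted-[] p y φ y<N rewrite lpkAux-before-max p y [] y<N | ≤⇒<ᵇ≡false (<⇒≤ y<N) =
      +-identityʳ _

    -- Between `y` and `b` the new maximum is a peak and rules out peaks at both neighbours. Behind
    -- `b` it leaves `y` and its neighbours alone, so a peak at `y` only shifts the weight.
    Inserted-∷ : ∀ p y b r φ → y < N → b < N → Inserted p y (b ∷ r) φ ≡
      φ (plusAux N (b ∷ r)) (suc (lpkAux N (b ∷ r)))
        + Inserted y b r (λ P l → φ P (𝟙 (peak p y b) + l))
    Inserted-∷ p y b r φ y<N b<N = cong₂ _+_
      (cong (φ _) (trans (lpkAux-before-max p y (b ∷ r) y<N) (lpkAux-at-max y b r y<N b<N)))
      (go (insertions N r))
      where
      go : ∀ L → Σstat p φ (map (y ∷_) (map (b ∷_) L)) ≡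
                 Σstat y (λ P l → φ P (𝟙 (peak p y b) + l)) (map (b ∷_) L)
      go [] = refl
      go (π ∷ L) = cong₂ _+_ (cong (φ _) (lpkAux-∷ p y b π)) (go L)

    -- The slot in front of `y` is left out, so a peak at `y` has only one of its two slots here:
    -- `𝟙 k + 2 * l` instead of `2 * (𝟙 k + l)`.
    Inserted-outcome : ∀ p y b r φ → y < N → b < N → All (_< N) r →
      let P = plusAux y (b ∷ r) ; k = peak p y b ; l = lpkAux y (b ∷ r) in
      Σ ℕ λ q → Inserted p y (b ∷ r) φ ≡ outcome P (𝟙 k + 2 * l) q (𝟙 k + l) φ
        × q + (𝟙 k + 2 * l) + 𝟙 (not P) ≡ length (b ∷ r)
    Inserted-outcome p y b [] φ y<N b<N [] with Inserted-∷ p y b [] φ y<N b<N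
    ... | eq rewrite Inserted-[] y b (λ P l → φ P (𝟙 (peak p y b) + l)) b<N | <⇒<ᵇ≡true b<N
        | ∧-comm (p <ᵇ y) (b <ᵇ y) with b <ᵇ y | p <ᵇ y
    ... | true  | true  = 0 , trans eq (one-term (φ true 1) _ 0) , refl
      where
      one-term : ∀ a b c → a + b ≡ 1 * a + 0 * c + b
      one-term = solve-∀
    ... | true  | false = 1 , trans eq (cong (_+ φ false 0) (sym (+-identityʳ (φ true 1)))) , refl
    ... | false | _     = 0 , eq , refl
    Inserted-outcome p y b (c ∷ r) φ y<N b<N (c<N ∷ r<N)
      with Inserted-∷ p y b (c ∷ r) φ y<N b<N
         | Inserted-outcome y b c r (λ P l → φ P (𝟙 (peak p y b) + l)) b<N c<N r<N
    ... | eq | q , ih , tot rewrite lpkAux-after-max b c r b<N | lpkAux-∷ y b c r =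
      _ , trans eq (trans (cong (φ P (suc (lpkAux b (c ∷ r))) +_) ih)
            (front-outcome P (lpkAux b (c ∷ r)) q φ k k′ (¬both-peaks p y b c)))
        , trans (front-total k k′ (lpkAux b (c ∷ r)) q (𝟙 (not P)) (¬both-peaks p y b c)) (cong suc tot)
      where
      P = plusAux b (c ∷ r)
      k = peak p y b
      k′ = peak y b c

    -- The front slot is added back. The letter `p` before the word counts as no peak, so
    -- `front-outcome` applies with k = false, and every peak now has both its slots.
    insertions-outcome : ∀ p y r φ → p ≤ y → p < N → y < N → All (_< N) r →
      let P = plusAux p (y ∷ r) ; l = lpkAux p (y ∷ r) in
      Σ ℕ λ q → Σstat p φ (insertions N (y ∷ r)) ≡ outcome P (2 * l) q l φ
        × q + 2 * l + 𝟙 (not P) ≡ length (y ∷ r)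
    insertions-outcome p y [] φ p≤y p<N y<N []
      rewrite Inserted-[] p y φ y<N | lpkAux-at-max p y [] p<N y<N | <⇒<ᵇ≡true y<N
            | ≤⇒<ᵇ≡false p≤y = 0 , refl , refl
    insertions-outcome p y (b ∷ r) φ p≤y p<N y<N (b<N ∷ r<N)
      with Inserted-outcome p y b r φ y<N b<N r<N
    ... | q , ih , tot rewrite lpkAux-at-max p y (b ∷ r) p<N y<N | lpkAux-after-max y b r y<N
                           | lpkAux-∷ p y b r =
      _ , trans (cong (φ P (suc (lpkAux y (b ∷ r))) +_) ih)
            (front-outcome P (lpkAux y (b ∷ r)) q φ false k λ ())
        , trans (front-total false k (lpkAux y (b ∷ r)) q (𝟙 (not P)) λ ()) (cong suc tot)
      where
      P = plusAux y (b ∷ r)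
      k = peak p y b

  -- Recurrences for the coefficients.

  #E #O : ℕ → ℕ → ℕ
  #E n k = length (filterᵇ (λ π → isPlus π ∧ (lpk π ≡ᵇ k)) (perms n))
  #O n k = length (filterᵇ (λ π → not (isPlus π) ∧ (lpk π ≡ᵇ k)) (perms n))

  φE φO : ℕ → Bool → ℕ → ℕ
  φE k P l = 𝟙 (P ∧ (l ≡ᵇ k))
  φO k P l = 𝟙 (not P ∧ (l ≡ᵇ k))

  length-filterᵇ : ∀ {A : Set} (p : A → Bool) xs → length (filterᵇ p xs) ≡ sum (map (𝟙 ∘ p) xs)
  length-filterᵇ p [] = refl
  length-filterᵇ p (x ∷ xs) with p x
  ... | true = cong suc (length-filterᵇ p xs)
  ... | false = length-filterᵇ p xs

  Σstat-concatMap : ∀ p φ (f : List ℕ → List (List ℕ)) L →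
    Σstat p φ (concatMap f L) ≡ sum (map (λ π → Σstat p φ (f π)) L)
  Σstat-concatMap p φ f [] = refl
  Σstat-concatMap p φ f (π ∷ L) = begin
    sum (map h (f π ++ concatMap f L))               ≡⟨ cong sum (map-++ h (f π) _) ⟩
    sum (map h (f π) ++ map h (concatMap f L))       ≡⟨ sum-++ (map h (f π)) _ ⟩
    Σstat p φ (f π) + Σstat p φ (concatMap f L)      ≡⟨ cong (Σstat p φ (f π) +_) (Σstat-concatMap p φ f L) ⟩
    Σstat p φ (f π) + sum (map (λ π → Σstat p φ (f π)) L) ∎
    where
    open ≡-Reasoning
    h : List ℕ → ℕ
    h ρ = φ (plusAux p ρ) (lpkAux p ρ)

  sum-linear : ∀ {A : Set} (f g h u : A → ℕ) a b c L →
    All (λ x → f x + a * g x ≡ b * h x + c * g x + u x) L →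
    sum (map f L) + a * sum (map g L) ≡ b * sum (map h L) + c * sum (map g L) + sum (map u L)
  sum-linear f g h u a b c [] [] = ring a b c
    where
    ring : ∀ a b c → 0 + a * 0 ≡ b * 0 + c * 0 + 0
    ring = solve-∀
  sum-linear f g h u a b c (x ∷ L) (e ∷ es) = begin
    (f x + F) + a * (g x + G)                         ≡⟨ left (f x) F a (g x) G ⟩
    (f x + a * g x) + (F + a * G)                     ≡⟨ cong₂ _+_ e (sum-linear f g h u a b c L es) ⟩
    (b * h x + c * g x + u x) + (b * H + c * G + U)   ≡⟨ right b (h x) H c (g x) G (u x) U ⟩
    b * (h x + H) + c * (g x + G) + (u x + U)         ∎
    where
    open ≡-Reasoning
    F = sum (map f L)
    G = sum (map g L)
    H = sum (map h L)
    U = sum (map u L)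
    left : ∀ f F a g G → (f + F) + a * (g + G) ≡ (f + a * g) + (F + a * G)
    left = solve-∀
    right : ∀ b h H c g G u U →
      (b * h + c * g + u) + (b * H + c * G + U) ≡ b * (h + H) + c * (g + G) + (u + U)
    right = solve-∀

  -- Under the indicator, the number of slots next to peaks turns into a multiple of the exponent k;
  -- this is where the derivative comes from.
  ≡ᵇ-subst : ∀ l k → l * 𝟙 (l ≡ᵇ k) ≡ k * 𝟙 (l ≡ᵇ k)
  ≡ᵇ-subst l k with l ≡ᵇ k in eq
  ... | true = cong (_* 1) (≡ᵇ⇒≡ l k (subst T (sym eq) tt))
  ... | false = trans (*-zeroʳ l) (sym (*-zeroʳ k))

  Outcome : ℕ → List ℕ → Set
  Outcome n π = ∀ φ → Σ ℕ λ q →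
    Σstat 0 φ (insertions (suc n) π) ≡ outcome (isPlus π) (2 * lpk π) q (lpk π) φ
      × q + 2 * lpk π + 𝟙 (not (isPlus π)) ≡ n

  Perm-Outcome : ∀ {n π} → Perm (suc n) π → Outcome (suc n) π
  Perm-Outcome {n} {y ∷ r} (refl , y≤n ∷ r≤n) φ =
    insertions-outcome (suc (suc n)) 0 y r φ z≤n (s≤s z≤n) (s≤s y≤n) (All.map s≤s r≤n)

  -- Sums a pointwise identity in which `q` is known only through the slot count. The term with `a`
  -- on the left is a subtraction kept within ℕ.
  perms-rec : ∀ n (φ g h u : Bool → ℕ → ℕ) a b c →
    (∀ P q l → q + 2 * l + 𝟙 (not P) ≡ suc n →
       outcome P (2 * l) q l φ + a * g P l ≡ b * h P l + c * g P l + u P l) →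
    Σstat 0 φ (perms (suc (suc n))) + a * Σstat 0 g (perms (suc n))
      ≡ b * Σstat 0 h (perms (suc n)) + c * Σstat 0 g (perms (suc n)) + Σstat 0 u (perms (suc n))
  perms-rec n φ g h u a b c identity
    rewrite Σstat-concatMap 0 φ (insertions (suc (suc n))) (perms (suc n)) =
    sum-linear _ _ _ _ a b c (perms (suc n)) (All.map pointwise (perms-Perm (suc n)))
    where
    pointwise : ∀ {π} → Perm (suc n) π →
      Σstat 0 φ (insertions (suc (suc n)) π) + a * g (isPlus π) (lpk π)
        ≡ b * h (isPlus π) (lpk π) + c * g (isPlus π) (lpk π) + u (isPlus π) (lpk π)
    pointwise {π} ok with Perm-Outcome ok φ
    ... | q , eq , tot = trans (cong (_+ a * g (isPlus π) (lpk π)) eq) (identity (isPlus π) q (lpk π) tot)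

  #E-Σstat : ∀ n k → #E n k ≡ Σstat 0 (φE k) (perms n)
  #E-Σstat n k = length-filterᵇ _ (perms n)

  #O-Σstat : ∀ n k → #O n k ≡ Σstat 0 (φO k) (perms n)
  #O-Σstat n k = length-filterᵇ _ (perms n)

  -- A final descent with j + 1 left peaks arises by 2 (j + 1) insertions from the same side with j
  -- + 1 peaks, by n + 1 - 2 j from the same side with j, and by the insertion before the last
  -- letter from the other side with j.
  #E-suc : ∀ n j → #E (suc (suc n)) (suc j) + 2 * j * #E (suc n) j
    ≡ 2 * suc j * #E (suc n) (suc j) + suc n * #E (suc n) j + #O (suc n) j
  #E-suc n j rewrite #E-Σstat (suc (suc n)) (suc j) | #E-Σstat (suc n) j | #E-Σstat (suc n) (suc j)
    | #O-Σstat (suc n) j = perms-rec n (φE (suc j)) (φE j) (φE (suc j)) (φO j)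
        (2 * j) (2 * suc j) (suc n) identity
    where
    identity : ∀ P q l → q + 2 * l + 𝟙 (not P) ≡ suc n →
      outcome P (2 * l) q l (φE (suc j)) + 2 * j * φE j P l
        ≡ 2 * suc j * φE (suc j) P l + suc n * φE j P l + φO j P l
    identity true q l tot = trans (left l q j x y)
      (trans (cong₂ (λ a b → 2 * a + q * y + 2 * b) (≡ᵇ-subst l (suc j)) (sym (≡ᵇ-subst l j)))
        (trans (right l q j x y) (cong (λ m → 2 * suc j * x + m * y + 0) tot)))
      where
      x = 𝟙 (l ≡ᵇ suc j)
      y = 𝟙 (l ≡ᵇ j)
      left : ∀ l q j x y → 2 * l * x + q * y + 0 + 2 * j * y ≡ 2 * (l * x) + q * y + 2 * (j * y)
      left = solve-∀
      right : ∀ l q j x y → 2 * (suc j * x) + q * y + 2 * (l * y)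
        ≡ 2 * suc j * x + (q + 2 * l + 0) * y + 0
      right = solve-∀
    identity false q l _ = ring l q j (suc n) (𝟙 (l ≡ᵇ j))
      where
      ring : ∀ l q j n y → 2 * l * 0 + q * 0 + y + 0 + 2 * j * 0 ≡ 2 * suc j * 0 + n * 0 + y
      ring = solve-∀

  -- Insertion at the end keeps the peaks and leads here from both sides: it adds 1 to 2 (j + 1) and
  -- brings in E at the same index. One slot fewer creates a peak, hence `suc (2 * j)`.
  #O-suc : ∀ n j → #O (suc (suc n)) (suc j) + suc (2 * j) * #O (suc n) j
    ≡ suc (2 * suc j) * #O (suc n) (suc j) + suc n * #O (suc n) j + #E (suc n) (suc j)
  #O-suc n j rewrite #O-Σstat (suc (suc n)) (suc j) | #O-Σstat (suc n) j | #O-Σstat (suc n) (suc j)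
    | #E-Σstat (suc n) (suc j) = perms-rec n (φO (suc j)) (φO j) (φO (suc j)) (φE (suc j))
        (suc (2 * j)) (suc (2 * suc j)) (suc n) identity
    where
    identity : ∀ P q l → q + 2 * l + 𝟙 (not P) ≡ suc n →
      outcome P (2 * l) q l (φO (suc j)) + suc (2 * j) * φO j P l
        ≡ suc (2 * suc j) * φO (suc j) P l + suc n * φO j P l + φE (suc j) P l
    identity true q l _ = ring l q j (suc n) (𝟙 (l ≡ᵇ suc j))
      where
      ring : ∀ l q j n y → 2 * l * 0 + q * 0 + y + suc (2 * j) * 0 ≡ suc (2 * suc j) * 0 + n * 0 + y
      ring = solve-∀
    identity false q l tot = trans (left l q j x y)
      (trans (cong₂ (λ a b → 2 * a + x + q * y + y + 2 * b) (≡ᵇ-subst l (suc j)) (sym (≡ᵇ-subst l j)))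
        (trans (right l q j x y) (cong (λ m → suc (2 * suc j) * x + m * y + 0) tot)))
      where
      x = 𝟙 (l ≡ᵇ suc j)
      y = 𝟙 (l ≡ᵇ j)
      left : ∀ l q j x y → 2 * l * x + q * y + 0 + x + suc (2 * j) * y
        ≡ 2 * (l * x) + x + q * y + y + 2 * (j * y)
      left = solve-∀
      right : ∀ l q j x y → 2 * (suc j * x) + x + q * y + y + 2 * (l * y)
        ≡ suc (2 * suc j) * x + (q + 2 * l + 1) * y + 0
      right = solve-∀

  #O-zero : ∀ n → #O (suc (suc n)) 0 ≡ #O (suc n) 0 + #E (suc n) 0
  #O-zero n rewrite #O-Σstat (suc (suc n)) 0 | #O-Σstat (suc n) 0 | #E-Σstat (suc n) 0 =
    trans (left (Σstat 0 (φO 0) (perms (suc (suc n)))))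
      (trans (perms-rec n (φO 0) (φO 0) (φO 0) (φE 0) 0 1 0 identity)
        (right (Σstat 0 (φO 0) (perms (suc n))) _))
    where
    left : ∀ a → a ≡ a + 0
    left = solve-∀
    right : ∀ a b → 1 * a + 0 + b ≡ a + b
    right = solve-∀
    identity : ∀ P q l → q + 2 * l + 𝟙 (not P) ≡ suc n →
      outcome P (2 * l) q l (φO 0) + 0 * φO 0 P l ≡ 1 * φO 0 P l + 0 * φO 0 P l + φE 0 P l
    identity true q l _ = ring l q (𝟙 (l ≡ᵇ 0))
      where
      ring : ∀ l q x → 2 * l * 0 + q * 0 + x + 0 ≡ x
      ring = solve-∀
    identity false q l _ = trans (cong (λ z → z + q * 0 + 0 + x + 0) (*-assoc 2 l x))
      (trans (cong (λ z → 2 * z + q * 0 + 0 + x + 0) (≡ᵇ-subst l 0)) (ring q x))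
      where
      x = 𝟙 (l ≡ᵇ 0)
      ring : ∀ q x → 0 + q * 0 + 0 + x + 0 ≡ 1 * x + 0 + 0
      ring = solve-∀

  #E-zero : ∀ n → #E (suc n) 0 ≡ 0
  #E-zero zero = refl
  #E-zero (suc n) rewrite #E-Σstat (suc (suc n)) 0 =
    -- No insertion produces a final descent without a left peak; the sum placed on both sides (a =
    -- 1, u = `φE 0`) cancels and leaves 0.
    +-cancelʳ-≡ (1 * Σstat 0 (φE 0) (perms (suc n))) _ 0
      (trans (perms-rec n (φE 0) (φE 0) (φE 0) (φE 0) 1 0 0 identity)
        (sym (+-identityʳ (Σstat 0 (φE 0) (perms (suc n))))))
    where
    identity : ∀ P q l → q + 2 * l + 𝟙 (not P) ≡ suc n →
      outcome P (2 * l) q l (φE 0) + 1 * φE 0 P l ≡ φE 0 P l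
    identity true q l _ = trans (cong (λ z → z + q * 0 + 0 + 1 * x) (*-assoc 2 l x))
      (trans (cong (λ z → 2 * z + q * 0 + 0 + 1 * x) (≡ᵇ-subst l 0)) (ring q x))
      where
      x = 𝟙 (l ≡ᵇ 0)
      ring : ∀ q x → 0 + q * 0 + 0 + 1 * x ≡ x
      ring = solve-∀
    identity false q l _ = ring l q
      where
      ring : ∀ l q → 2 * l * 0 + q * 0 + 0 + 0 + 0 ≡ 0
      ring = solve-∀

  -- Vanishing and positivity of coefficients: the exact degrees.

  -- The lower coefficient x disappears in one of two ways: it vanishes itself, or, at the boundary
  -- index, no slot creates a peak and both its factors agree.
  vanish-cancel : ∀ {a m x y} u b {z} → u + a * x ≡ b * y + m * x + z → (x ≡ 0 ⊎ a ≡ m) →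
    y ≡ 0 → z ≡ 0 → u ≡ 0
  vanish-cancel {a} {m} u b eq (inj₁ refl) refl refl
    rewrite *-zeroʳ a | *-zeroʳ b | *-zeroʳ m = trans (sym (+-identityʳ u)) eq
  vanish-cancel {a} {x = x} u b eq (inj₂ refl) refl refl
    rewrite *-zeroʳ b = +-cancelʳ-≡ (a * x) u 0 (trans eq (+-identityʳ (a * x)))

  2*suc : ∀ j → 2 * suc j ≡ suc (suc (2 * j))
  2*suc = *-suc 2

  #E-vanish : ∀ n k → suc n < 2 * k → #E (suc n) k ≡ 0
  #O-vanish : ∀ n k → suc n ≤ 2 * k → #O (suc n) k ≡ 0
  #E-vanish zero k _ = refl
  #E-vanish (suc n) (suc j) n<2k = vanish-cancel _ (2 * suc j) (#E-suc n j)
    (case m≤n⇒m<n∨m≡n n≤2j of λ where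
      (inj₁ lt) → inj₁ (#E-vanish n j lt)
      (inj₂ eq) → inj₂ (sym eq))
    (#E-vanish n (suc j) (<-trans (n<1+n _) n<2k)) (#O-vanish n j n≤2j)
    where
    n≤2j : suc n ≤ 2 * j
    n≤2j = s≤s⁻¹ (s≤s⁻¹ (subst (suc (suc n) <_) (2*suc j) n<2k))
  #O-vanish zero (suc k) _ = refl
  #O-vanish (suc n) (suc j) n≤2k = vanish-cancel _ (suc (2 * suc j)) (#O-suc n j)
    (case m≤n⇒m<n∨m≡n n≤2j of λ where
      (inj₁ lt) → inj₁ (#O-vanish n j lt)
      (inj₂ eq) → inj₂ (cong suc (sym eq)))
    (#O-vanish n (suc j) (≤-trans (n≤1+n _) n≤2k)) (#E-vanish n (suc j) n≤2k)
    where
    n≤2j : n ≤ 2 * j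
    n≤2j = s≤s⁻¹ (s≤s⁻¹ (subst (suc (suc n) ≤_) (2*suc j) n≤2k))

  -- For E the contribution of O is positive, and n + 1 ≥ 2 j absorbs the subtracted term. For O the
  -- net factor n + 1 - (2 j + 1) of the lower coefficient is itself positive.
  #E-pos : ∀ n j → 2 * suc j ≤ suc (suc n) → 0 < #E (suc (suc n)) (suc j)
  #O-pos : ∀ n k → 2 * k < suc n → 0 < #O (suc n) k
  #E-pos n j 2k≤n = +-cancelʳ-< (2 * j * #E (suc n) j) 0 _ (begin-strict
    2 * j * #E (suc n) j                               ≤⟨ *-monoˡ-≤ (#E (suc n) j) (m≤n⇒m≤1+n 2j≤n) ⟩
    suc n * #E (suc n) j                               <⟨ m<m+n _ (#O-pos n j (s≤s 2j≤n)) ⟩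
    suc n * #E (suc n) j + #O (suc n) j                ≤⟨ +-monoˡ-≤ _ (m≤n+m _ (2 * suc j * #E (suc n) (suc j))) ⟩
    2 * suc j * #E (suc n) (suc j) + suc n * #E (suc n) j + #O (suc n) j ≡⟨ #E-suc n j ⟨
    #E (suc (suc n)) (suc j) + 2 * j * #E (suc n) j    ∎)
    where
    open ≤-Reasoning
    2j≤n : 2 * j ≤ n
    2j≤n = s≤s⁻¹ (s≤s⁻¹ (subst (_≤ suc (suc n)) (2*suc j) 2k≤n))
  #O-pos zero zero _ = s≤s z≤n
  #O-pos zero (suc k) 2k<1 with s≤s () ← subst (_< 1) (2*suc k) 2k<1
  #O-pos (suc n) zero _ rewrite #O-zero n = <-≤-trans (#O-pos n 0 (s≤s z≤n)) (m≤m+n _ _)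
  #O-pos (suc n) (suc j) 2k<n = +-cancelʳ-< (suc (2 * j) * #O (suc n) j) 0 _ (begin-strict
    suc (2 * j) * #O (suc n) j                         <⟨ *-monoˡ-< (#O (suc n) j) ⦃ O≢0 ⦄ (s≤s 2j<n) ⟩
    suc n * #O (suc n) j                               ≤⟨ m≤n+m _ (suc (2 * suc j) * #O (suc n) (suc j)) ⟩
    suc (2 * suc j) * #O (suc n) (suc j) + suc n * #O (suc n) j ≤⟨ m≤m+n _ _ ⟩
    suc (2 * suc j) * #O (suc n) (suc j) + suc n * #O (suc n) j + #E (suc n) (suc j) ≡⟨ #O-suc n j ⟨
    #O (suc (suc n)) (suc j) + suc (2 * j) * #O (suc n) j ∎)
    where
    open ≤-Reasoning
    2j<n : 2 * j < n
    2j<n = s≤s⁻¹ (s≤s⁻¹ (subst (_< suc (suc n)) (2*suc j) 2k<n))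
    O≢0 = >-nonZero (#O-pos n j (m<n⇒m<1+n 2j<n))

  -- Coefficients

  coeff-applyUpTo : ∀ (f : ℕ → ℤ) (g : ℕ → ℕ) m k → (m ≤ k → f (g k) ≡ ℤ.+ 0) →
    coeff (map f (applyUpTo g m)) k ≡ f (g k)
  coeff-applyUpTo f g zero k out = sym (out z≤n)
  coeff-applyUpTo f g (suc m) zero out = refl
  coeff-applyUpTo f g (suc m) (suc k) out = coeff-applyUpTo f (g ∘ suc) m k (out ∘ s≤s)

  coeff-TE : ∀ n k → coeff (TE (suc n)) k ≡ ℤ.+ #E (suc n) k
  coeff-TE n k = coeff-applyUpTo _ (λ i → i) (suc (suc n)) k
    λ n<k → cong ℤ.+_ (#E-vanish n k (<-≤-trans n<k (m≤m+n k _)))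

  coeff-TO : ∀ n k → coeff (TO (suc n)) k ≡ ℤ.+ #O (suc n) k
  coeff-TO n k = coeff-applyUpTo _ (λ i → i) (suc (suc n)) k
    λ n<k → cong ℤ.+_ (#O-vanish n k (≤-trans (<⇒≤ n<k) (m≤m+n k _)))

  coeff-⊕ : ∀ p q k → coeff (p ⊕ q) k ≡ coeff p k ℤ.+ coeff q k
  coeff-⊕ [] q k = sym (ℤ.+-identityˡ _)
  coeff-⊕ (a ∷ p) [] k = sym (ℤ.+-identityʳ _)
  coeff-⊕ (a ∷ p) (b ∷ q) zero = refl
  coeff-⊕ (a ∷ p) (b ∷ q) (suc k) = coeff-⊕ p q k

  coeff-scale : ∀ c p k → coeff (scale c p) k ≡ c ℤ.* coeff p k
  coeff-scale c [] k = sym (ℤ.*-zeroʳ c)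
  coeff-scale c (a ∷ p) zero = refl
  coeff-scale c (a ∷ p) (suc k) = coeff-scale c p k

  coeff-derivAux : ∀ m p k → coeff (derivAux m p) k ≡ ℤ.+ (k + m) ℤ.* coeff p k
  coeff-derivAux m [] k = sym (ℤ.*-zeroʳ (ℤ.+ (k + m)))
  coeff-derivAux m (a ∷ p) zero = refl
  coeff-derivAux m (a ∷ p) (suc k) =
    trans (coeff-derivAux (suc m) p k) (cong (λ i → ℤ.+ i ℤ.* coeff p k) (+-suc k m))

  coeff-deriv : ∀ p k → coeff (deriv p) k ≡ ℤ.+ suc k ℤ.* coeff p (suc k)
  coeff-deriv [] k = sym (ℤ.*-zeroʳ (ℤ.+ suc k))
  coeff-deriv (a ∷ p) k =
    trans (coeff-derivAux 1 p k) (cong (λ i → ℤ.+ i ℤ.* coeff p k) (+-comm k 1))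

  coeff-mulX-deriv : ∀ p k → coeff (mulX (deriv p)) k ≡ ℤ.+ k ℤ.* coeff p k
  coeff-mulX-deriv p zero = refl
  coeff-mulX-deriv p (suc k) = coeff-deriv p k

  coeff-2x[1-x]deriv : ∀ p k → coeff (scale (ℤ.+ 2) (mulX (mul1mX (deriv p)))) (suc k) ≡
    ℤ.+ 2 ℤ.* (ℤ.+ suc k ℤ.* coeff p (suc k) ℤ.+ ℤ.-[1+ 0 ] ℤ.* (ℤ.+ k ℤ.* coeff p k))
  coeff-2x[1-x]deriv p k
    rewrite coeff-scale (ℤ.+ 2) (mul1mX (deriv p)) k
          | coeff-⊕ (deriv p) (scale ℤ.-[1+ 0 ] (mulX (deriv p))) k
          | coeff-scale ℤ.-[1+ 0 ] (mulX (deriv p)) k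
          | coeff-deriv p k | coeff-mulX-deriv p k = refl

  pos-linear : ∀ u a x b y c z → u + a * x ≡ b * y + c * x + z →
    ℤ.+ u ≡ ℤ.+ b ℤ.* ℤ.+ y ℤ.+ ℤ.+ c ℤ.* ℤ.+ x ℤ.+ ℤ.+ z ℤ.- ℤ.+ a ℤ.* ℤ.+ x
  pos-linear u a x b y c z eq = begin
    ℤ.+ u                                              ≡⟨ ring (ℤ.+ u) (ℤ.+ a ℤ.* ℤ.+ x) ⟩
    (ℤ.+ u ℤ.+ ℤ.+ a ℤ.* ℤ.+ x) ℤ.- ℤ.+ a ℤ.* ℤ.+ x    ≡⟨ cong (ℤ._- ℤ.+ a ℤ.* ℤ.+ x) cast ⟩
    _                                                  ∎
    where
    open ≡-Reasoning
    ring : ∀ u v → u ≡ (u ℤ.+ v) ℤ.- v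
    ring = ℤ-solve-∀
    cast : ℤ.+ u ℤ.+ ℤ.+ a ℤ.* ℤ.+ x ≡ ℤ.+ b ℤ.* ℤ.+ y ℤ.+ ℤ.+ c ℤ.* ℤ.+ x ℤ.+ ℤ.+ z
    cast rewrite sym (ℤ.pos-* a x) | sym (ℤ.pos-* b y) | sym (ℤ.pos-* c x) = cong ℤ.+_ eq

  TE-rec : ∀ n → TE (suc (suc n)) ≈ₚ RHS-E (suc n)
  TE-rec n zero = trans (coeff-TE (suc n) 0) (trans (cong ℤ.+_ (#E-zero (suc n)))
    (sym (cong (ℤ._+ ℤ.+ 0) (ℤ.*-zeroʳ (ℤ.+ suc n)))))
  TE-rec n (suc j)
    rewrite coeff-TE (suc n) (suc j)
          | coeff-⊕ (scale (ℤ.+ suc n) (mulX (TE (suc n))))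
              (scale (ℤ.+ 2) (mulX (mul1mX (deriv (TE (suc n))))) ⊕ mulX (TO (suc n))) (suc j)
          | coeff-⊕ (scale (ℤ.+ 2) (mulX (mul1mX (deriv (TE (suc n)))))) (mulX (TO (suc n))) (suc j)
          | coeff-scale (ℤ.+ suc n) (TE (suc n)) j
          | coeff-2x[1-x]deriv (TE (suc n)) j
          | coeff-TE n j | coeff-TE n (suc j) | coeff-TO n j
    = trans (pos-linear _ (2 * j) (#E (suc n) j) (2 * suc j) (#E (suc n) (suc j))
               (suc n) (#O (suc n) j) (#E-suc n j))
        (trans (cong₂ (λ a b → b ℤ.* E₁ ℤ.+ N ℤ.* E₀ ℤ.+ O₀ ℤ.- a ℤ.* E₀) (ℤ.pos-* 2 j) (ℤ.pos-* 2 (suc j)))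
          (ring (ℤ.+ j) (ℤ.+ suc j) N E₀ E₁ O₀))
    where
    N = ℤ.+ suc n
    E₀ = ℤ.+ #E (suc n) j
    E₁ = ℤ.+ #E (suc n) (suc j)
    O₀ = ℤ.+ #O (suc n) j
    ring : ∀ j j⁺ n e₀ e₁ o₀ → (ℤ.+ 2 ℤ.* j⁺) ℤ.* e₁ ℤ.+ n ℤ.* e₀ ℤ.+ o₀ ℤ.- (ℤ.+ 2 ℤ.* j) ℤ.* e₀
      ≡ n ℤ.* e₀ ℤ.+ (ℤ.+ 2 ℤ.* (j⁺ ℤ.* e₁ ℤ.+ ℤ.-[1+ 0 ] ℤ.* (j ℤ.* e₀)) ℤ.+ o₀)
    ring = ℤ-solve-∀

  TO-rec : ∀ n → TO (suc (suc n)) ≈ₚ RHS-O (suc n)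
  TO-rec n zero = trans (coeff-TO (suc n) 0) (trans (cong ℤ.+_ (#O-zero n))
    (sym (cong (λ z → z ℤ.+ ℤ.+ #O (suc n) 0 ℤ.+ ℤ.+ #E (suc n) 0) (ℤ.*-zeroʳ (ℤ.+ n)))))
  TO-rec n (suc j)
    rewrite coeff-TO (suc n) (suc j)
          | coeff-⊕ (scale (ℤ.+ n) (mulX (TO (suc n))) ⊕ TO (suc n))
              (scale (ℤ.+ 2) (mulX (mul1mX (deriv (TO (suc n))))) ⊕ TE (suc n)) (suc j)
          | coeff-⊕ (scale (ℤ.+ n) (mulX (TO (suc n)))) (TO (suc n)) (suc j)
          | coeff-⊕ (scale (ℤ.+ 2) (mulX (mul1mX (deriv (TO (suc n)))))) (TE (suc n)) (suc j)
          | coeff-scale (ℤ.+ n) (TO (suc n)) j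
          | coeff-2x[1-x]deriv (TO (suc n)) j
          | coeff-TO n j | coeff-TO n (suc j) | coeff-TE n (suc j)
    = trans (pos-linear _ (1 + 2 * j) (#O (suc n) j) (1 + 2 * suc j) (#O (suc n) (suc j))
               (suc n) (#E (suc n) (suc j)) (#O-suc n j))
        (trans (cong₂ (λ a b → (ℤ.+ 1 ℤ.+ b) ℤ.* O₁ ℤ.+ (ℤ.+ 1 ℤ.+ N) ℤ.* O₀ ℤ.+ E₁ ℤ.- (ℤ.+ 1 ℤ.+ a) ℤ.* O₀)
                  (ℤ.pos-* 2 j) (ℤ.pos-* 2 (suc j)))
          (ring (ℤ.+ j) (ℤ.+ suc j) N O₀ O₁ E₁))
    where
    N = ℤ.+ n
    O₀ = ℤ.+ #O (suc n) j
    O₁ = ℤ.+ #O (suc n) (suc j)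
    E₁ = ℤ.+ #E (suc n) (suc j)
    ring : ∀ j j⁺ n o₀ o₁ e₁ →
      (ℤ.+ 1 ℤ.+ ℤ.+ 2 ℤ.* j⁺) ℤ.* o₁ ℤ.+ (ℤ.+ 1 ℤ.+ n) ℤ.* o₀ ℤ.+ e₁ ℤ.- (ℤ.+ 1 ℤ.+ ℤ.+ 2 ℤ.* j) ℤ.* o₀
      ≡ (n ℤ.* o₀ ℤ.+ o₁) ℤ.+ (ℤ.+ 2 ℤ.* (j⁺ ℤ.* o₁ ℤ.+ ℤ.-[1+ 0 ] ℤ.* (j ℤ.* o₀)) ℤ.+ e₁)
    ring = ℤ-solve-∀

-- Integers in the real field and a ring solver.

module RealRootedness (R : RealField) where
  open RealField R
  open Recurrences
  module SO = IsStrictTotalOrder isStrictTotalOrder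
  open SO using (compare) renaming (trans to <-trans; irrefl to <-irrefl)

  commutativeRing : CommutativeRing _ _
  commutativeRing = record { isCommutativeRing = isCommutativeRing }
  module CR = CommutativeRing commutativeRing
  open Algebra.Properties.Ring CR.ring
    using (-0#≈0#; -‿distribˡ-*; -‿distribʳ-*; -‿involutive; -‿+-comm)

  ι : ℕ → Carrier
  ι = fromℕ R

  ι-+ : ∀ m n → ι (m ℕ.+ n) ≡ ι m + ι n
  ι-+ zero n = sym (CR.+-identityˡ _)
  ι-+ (suc m) n = trans (cong (1# +_) (ι-+ m n)) (sym (CR.+-assoc _ _ _))

  ι-* : ∀ m n → ι (m ℕ.* n) ≡ ι m * ι n
  ι-* zero n = sym (CR.zeroˡ _)
  ι-* (suc m) n = begin
    ι (n ℕ.+ m ℕ.* n)        ≡⟨ ι-+ n (m ℕ.* n) ⟩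
    ι n + ι (m ℕ.* n)        ≡⟨ cong₂ _+_ (sym (CR.*-identityˡ _)) (ι-* m n) ⟩
    1# * ι n + ι m * ι n     ≡⟨ CR.distribʳ _ _ _ ⟨
    (1# + ι m) * ι n         ∎
    where open ≡-Reasoning

  ιᶻ : ℤ → Carrier
  ιᶻ = fromℤ R

  ιᶻ-neg : ∀ a → ιᶻ (ℤ.- a) ≡ - ιᶻ a
  ιᶻ-neg (ℤ.+ zero) = sym -0#≈0#
  ιᶻ-neg (ℤ.+ suc n) = refl
  ιᶻ-neg ℤ.-[1+ n ] = sym (-‿involutive _)

  ιᶻ-⊖ : ∀ m n → ιᶻ (m ℤ.⊖ n) ≡ ι m + - ι n
  ιᶻ-⊖ m zero = trans (sym (CR.+-identityʳ _)) (cong (ι m +_) (sym -0#≈0#))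
  ιᶻ-⊖ zero (suc n) = sym (CR.+-identityˡ _)
  ιᶻ-⊖ (suc m) (suc n) = begin
    ιᶻ (suc m ℤ.⊖ suc n)                 ≡⟨ cong ιᶻ (ℤ.[1+m]⊖[1+n]≡m⊖n m n) ⟩
    ιᶻ (m ℤ.⊖ n)                         ≡⟨ ιᶻ-⊖ m n ⟩
    ι m + - ι n                          ≡⟨ cong (_+ - ι n) (sym (CR.+-identityʳ _)) ⟩
    ι m + 0# + - ι n                     ≡⟨ cong (λ z → ι m + z + - ι n) (sym (CR.-‿inverseʳ 1#)) ⟩
    ι m + (1# + - 1#) + - ι n            ≡⟨ cong (_+ - ι n) (sym (CR.+-assoc _ _ _)) ⟩
    ι m + 1# + - 1# + - ι n              ≡⟨ CR.+-assoc _ _ _ ⟩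
    ι m + 1# + (- 1# + - ι n)            ≡⟨ cong₂ _+_ (CR.+-comm _ _) (-‿+-comm _ _) ⟩
    1# + ι m + - (1# + ι n)              ∎
    where open ≡-Reasoning

  ιᶻ-+ : ∀ a b → ιᶻ (a ℤ.+ b) ≡ ιᶻ a + ιᶻ b
  ιᶻ-+ (ℤ.+ m) (ℤ.+ n) = ι-+ m n
  ιᶻ-+ (ℤ.+ m) ℤ.-[1+ n ] = ιᶻ-⊖ m (suc n)
  ιᶻ-+ ℤ.-[1+ m ] (ℤ.+ n) = trans (ιᶻ-⊖ n (suc m)) (CR.+-comm _ _)
  ιᶻ-+ ℤ.-[1+ m ] ℤ.-[1+ n ] = begin
    - ι (suc (suc (m ℕ.+ n)))            ≡⟨ cong (λ i → - ι (suc i)) (sym (ℕ.+-suc m n)) ⟩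
    - ι (suc m ℕ.+ suc n)                ≡⟨ cong -_ (ι-+ (suc m) (suc n)) ⟩
    - (ι (suc m) + ι (suc n))            ≡⟨ -‿+-comm _ _ ⟨
    - ι (suc m) + - ι (suc n)            ∎
    where open ≡-Reasoning

  ιᶻ-+* : ∀ m b → ιᶻ (ℤ.+ m ℤ.* b) ≡ ι m * ιᶻ b
  ιᶻ-+* m (ℤ.+ n) = trans (cong ιᶻ (sym (ℤ.pos-* m n))) (ι-* m n)
  ιᶻ-+* m ℤ.-[1+ n ] = begin
    ιᶻ (ℤ.+ m ℤ.* ℤ.- ℤ.+ suc n)         ≡⟨ cong ιᶻ (ℤ.neg-distribʳ-* (ℤ.+ m) (ℤ.+ suc n)) ⟨
    ιᶻ (ℤ.- (ℤ.+ m ℤ.* ℤ.+ suc n))       ≡⟨ ιᶻ-neg (ℤ.+ m ℤ.* ℤ.+ suc n) ⟩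
    - ιᶻ (ℤ.+ m ℤ.* ℤ.+ suc n)           ≡⟨ cong -_ (ιᶻ-+* m (ℤ.+ suc n)) ⟩
    - (ι m * ι (suc n))                  ≡⟨ -‿distribʳ-* _ _ ⟩
    ι m * - ι (suc n)                    ∎
    where open ≡-Reasoning

  ιᶻ-* : ∀ a b → ιᶻ (a ℤ.* b) ≡ ιᶻ a * ιᶻ b
  ιᶻ-* (ℤ.+ m) b = ιᶻ-+* m b
  ιᶻ-* ℤ.-[1+ m ] b = begin
    ιᶻ (ℤ.- ℤ.+ suc m ℤ.* b)             ≡⟨ cong ιᶻ (ℤ.neg-distribˡ-* (ℤ.+ suc m) b) ⟨
    ιᶻ (ℤ.- (ℤ.+ suc m ℤ.* b))           ≡⟨ ιᶻ-neg (ℤ.+ suc m ℤ.* b) ⟩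
    - ιᶻ (ℤ.+ suc m ℤ.* b)               ≡⟨ cong -_ (ιᶻ-+* (suc m) b) ⟩
    - (ι (suc m) * ιᶻ b)                 ≡⟨ -‿distribˡ-* _ _ ⟩
    - ι (suc m) * ιᶻ b                   ∎
    where open ≡-Reasoning

  private
    almostCommutativeRing : AlmostCommutativeRing _ _
    almostCommutativeRing = fromCommutativeRing commutativeRing

    -- Unlike fromℕ, this sends 1 to 1# on the nose, so that 1# is a literal for the solver.
    litℕ : ℕ → Carrier
    litℕ 0 = 0#
    litℕ 1 = 1#
    litℕ (suc (suc n)) = 1# + litℕ (suc n)

    lit : ℤ → Carrier
    lit (ℤ.+ n) = litℕ n
    lit ℤ.-[1+ n ] = - litℕ (suc n)

    litℕ≡ι : ∀ n → litℕ n ≡ ι n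
    litℕ≡ι 0 = refl
    litℕ≡ι 1 = sym (CR.+-identityʳ 1#)
    litℕ≡ι (suc (suc n)) = cong (1# +_) (litℕ≡ι (suc n))

    lit≡ιᶻ : ∀ a → lit a ≡ ιᶻ a
    lit≡ιᶻ (ℤ.+ n) = litℕ≡ι n
    lit≡ιᶻ ℤ.-[1+ n ] = cong -_ (litℕ≡ι (suc n))

    lit-morphism : CommutativeRing.rawRing ℤ.+-*-commutativeRing -Raw-AlmostCommutative⟶ almostCommutativeRing
    lit-morphism = record
      { ⟦_⟧ = lit
      ; +-homo = λ a b → trans (lit≡ιᶻ (a ℤ.+ b))
          (trans (ιᶻ-+ a b) (sym (cong₂ _+_ (lit≡ιᶻ a) (lit≡ιᶻ b))))
      ; *-homo = λ a b → trans (lit≡ιᶻ (a ℤ.* b))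
          (trans (ιᶻ-* a b) (sym (cong₂ _*_ (lit≡ιᶻ a) (lit≡ιᶻ b))))
      ; -‿homo = λ a → trans (lit≡ιᶻ (ℤ.- a)) (trans (ιᶻ-neg a) (sym (cong -_ (lit≡ιᶻ a))))
      ; 0-homo = refl ; 1-homo = refl }

    lit-≟ : ∀ a b → Maybe (lit a ≡ lit b)
    lit-≟ a b with a ℤ.≟ b
    ... | yes eq = just (cong lit eq)
    ... | no _ = nothing

  open Algebra.Solver.Ring _ almostCommutativeRing lit-morphism lit-≟
    using (solve; _:+_; _:*_; :-_; _:-_; _:=_; con; Polynomial)

  :0 :1 : ∀ {n} → Polynomial n
  :0 = con (ℤ.+ 0)
  :1 = con (ℤ.+ 1)

  infixl 6 _−_
  _−_ : Carrier → Carrier → Carrier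
  x − y = x + - y

  -- Ordered-field arithmetic.

  ≤-refl : ∀ {x} → x ≤ x
  ≤-refl = inj₂ refl

  <⇒≤ : ∀ {x y} → x < y → x ≤ y
  <⇒≤ = inj₁

  <-≤-trans : ∀ {x y z} → x < y → y ≤ z → x < z
  <-≤-trans x<y (inj₁ y<z) = <-trans x<y y<z
  <-≤-trans x<y (inj₂ refl) = x<y

  ≤-<-trans : ∀ {x y z} → x ≤ y → y < z → x < z
  ≤-<-trans (inj₁ x<y) y<z = <-trans x<y y<z
  ≤-<-trans (inj₂ refl) y<z = y<z

  ≤-trans : ∀ {x y z} → x ≤ y → y ≤ z → x ≤ z
  ≤-trans (inj₁ x<y) y≤z = inj₁ (<-≤-trans x<y y≤z)
  ≤-trans (inj₂ refl) y≤z = y≤z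

  ≤⇒≯ : ∀ {x y} → x ≤ y → ¬ (y < x)
  ≤⇒≯ x≤y y<x = <-irrefl refl (≤-<-trans x≤y y<x)

  <⇒≢ : ∀ {x y} → x < y → x ≢ y
  <⇒≢ x<y refl = <-irrefl refl x<y

  ≮⇒≥ : ∀ {x y} → ¬ (x < y) → y ≤ x
  ≮⇒≥ {x} {y} x≮y with compare x y
  ... | tri< x<y _ _ = ⊥-elim (x≮y x<y)
  ... | tri≈ _ refl _ = ≤-refl
  ... | tri> _ _ y<x = <⇒≤ y<x

  0<⇒< : ∀ {x y} → 0# < y − x → x < y
  0<⇒< {x} {y} p = subst₂ _<_ (CR.+-identityˡ x) (ring x y) (+-mono-< x p)
    where
    ring : ∀ x y → y − x + x ≡ y
    ring = solve 2 (λ x y → y :- x :+ x := y) refl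

  <⇒0< : ∀ {x y} → x < y → 0# < y − x
  <⇒0< {x} {y} p = subst (_< y − x) (CR.-‿inverseʳ x) (+-mono-< (- x) p)

  0≤⇒≤ : ∀ {x y} → 0# ≤ y − x → x ≤ y
  0≤⇒≤ (inj₁ p) = inj₁ (0<⇒< p)
  0≤⇒≤ {x} {y} (inj₂ p) = inj₂ (trans (sym (CR.+-identityˡ x)) (trans (cong (_+ x) p) (ring x y)))
    where
    ring : ∀ x y → y − x + x ≡ y
    ring = solve 2 (λ x y → y :- x :+ x := y) refl

  ≤⇒0≤ : ∀ {x y} → x ≤ y → 0# ≤ y − x
  ≤⇒0≤ (inj₁ p) = inj₁ (<⇒0< p)
  ≤⇒0≤ {x} (inj₂ refl) = inj₂ (sym (CR.-‿inverseʳ x))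

  +-pos : ∀ {x y} → 0# < x → 0# ≤ y → 0# < x + y
  +-pos {x} {y} 0<x 0≤y = <-≤-trans 0<x (0≤⇒≤ (subst (0# ≤_) (ring x y) 0≤y))
    where
    ring : ∀ x y → y ≡ x + y − x
    ring = solve 2 (λ x y → y := x :+ y :- x) refl

  +-nonneg : ∀ {x y} → 0# ≤ x → 0# ≤ y → 0# ≤ x + y
  +-nonneg (inj₁ 0<x) 0≤y = inj₁ (+-pos 0<x 0≤y)
  +-nonneg {y = y} (inj₂ refl) 0≤y = subst (0# ≤_) (sym (CR.+-identityˡ y)) 0≤y

  *-nonneg : ∀ {x y} → 0# ≤ x → 0# ≤ y → 0# ≤ x * y
  *-nonneg (inj₁ 0<x) (inj₁ 0<y) = inj₁ (*-pos 0<x 0<y)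
  *-nonneg {x} (inj₁ _) (inj₂ refl) = inj₂ (sym (CR.zeroʳ x))
  *-nonneg {y = y} (inj₂ refl) _ = inj₂ (sym (CR.zeroˡ y))

  neg-pos : ∀ {x} → x < 0# → 0# < - x
  neg-pos {x} x<0 = subst (0# <_) (CR.+-identityˡ (- x)) (<⇒0< x<0)

  neg-nonneg : ∀ {x} → x ≤ 0# → 0# ≤ - x
  neg-nonneg {x} x≤0 = subst (0# ≤_) (CR.+-identityˡ (- x)) (≤⇒0≤ x≤0)

  pos-neg : ∀ {x} → 0# < - x → x < 0#
  pos-neg {x} p = 0<⇒< (subst (0# <_) (sym (CR.+-identityˡ (- x))) p)

  square-pos : ∀ {x} → x ≢ 0# → 0# < x * x
  square-pos {x} x≢0 with compare x 0#
  ... | tri< x<0 _ _ = subst (0# <_) (ring x) (*-pos (neg-pos x<0) (neg-pos x<0))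
    where
    ring : ∀ x → - x * - x ≡ x * x
    ring = solve 1 (λ x → :- x :* :- x := x :* x) refl
  ... | tri≈ _ x≡0 _ = ⊥-elim (x≢0 x≡0)
  ... | tri> _ _ 0<x = *-pos 0<x 0<x

  square-nonneg : ∀ x → 0# ≤ x * x
  square-nonneg x with compare x 0#
  ... | tri< _ x≢0 _ = inj₁ (square-pos x≢0)
  ... | tri≈ _ refl _ = inj₂ (sym (CR.zeroˡ x))
  ... | tri> _ x≢0 _ = inj₁ (square-pos x≢0)

  *-cancel-pos : ∀ {x y} → 0# < x → 0# < x * y → 0# < y
  *-cancel-pos {x} {y} 0<x 0<xy with compare y 0#
  ... | tri> _ _ 0<y = 0<y
  ... | tri≈ _ refl _ = ⊥-elim (<-irrefl (sym (CR.zeroʳ x)) 0<xy)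
  ... | tri< y<0 _ _ = ⊥-elim (<-irrefl (sym (CR.-‿inverseʳ (x * y)))
          (<-≤-trans (*-pos 0<x (neg-pos y<0)) (0≤⇒≤ (subst (0# ≤_) (ring x y) (<⇒≤ 0<xy)))))
    where
    ring : ∀ x y → x * y ≡ x * y − x * y − x * - y
    ring = solve 2 (λ x y → x :* y := x :* y :- x :* y :- x :* :- y) refl

  pos⇒≢0 : ∀ {x} → 0# < x → x ≢ 0#
  pos⇒≢0 0<x x≡0 = <⇒≢ 0<x (sym x≡0)

  *-pos⇒≢0ˡ : ∀ {x y} → 0# < x * y → x ≢ 0#
  *-pos⇒≢0ˡ {y = y} p refl = <-irrefl (sym (CR.zeroˡ y)) p

  *-pos⇒≢0ʳ : ∀ {x y} → 0# < x * y → y ≢ 0#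
  *-pos⇒≢0ʳ {x} p refl = <-irrefl (sym (CR.zeroʳ x)) p

  *-zero-cancel : ∀ {x y} → x ≢ 0# → x * y ≡ 0# → y ≡ 0#
  *-zero-cancel {x} {y} x≢0 xy≡0 with inverse x x≢0
  ... | t , xt≡1 = begin
    y             ≡⟨ CR.*-identityˡ y ⟨
    1# * y        ≡⟨ cong (_* y) xt≡1 ⟨
    x * t * y     ≡⟨ solve 3 (λ x t y → x :* t :* y := t :* (x :* y)) refl x t y ⟩
    t * (x * y)   ≡⟨ cong (t *_) xy≡0 ⟩
    t * 0#        ≡⟨ CR.zeroʳ t ⟩
    0#            ∎
    where open ≡-Reasoning

  inverse-pos : ∀ {x} → 0# < x → Σ Carrier λ t → x * t ≡ 1# × 0# < t
  inverse-pos {x} 0<x with inverse x (pos⇒≢0 0<x)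
  ... | t , xt≡1 = t , xt≡1 , *-cancel-pos 0<x (subst (0# <_) (sym xt≡1) 0<1)

  ι-nonneg : ∀ n → 0# ≤ ι n
  ι-nonneg zero = ≤-refl
  ι-nonneg (suc n) = <⇒≤ (+-pos 0<1 (ι-nonneg n))

  ι-pos : ∀ {n} → 0 ℕ.< n → 0# < ι n
  ι-pos {suc n} _ = +-pos 0<1 (ι-nonneg n)

  halve-nonneg : ∀ {x} → 0# ≤ x + x → 0# ≤ x
  halve-nonneg {x} p = ≮⇒≥ λ x<0 → ≤⇒≯ p
    (pos-neg (subst (0# <_) (ring x) (+-pos (neg-pos x<0) (<⇒≤ (neg-pos x<0)))))
    where
    ring : ∀ x → - x + - x ≡ - (x + x)
    ring = solve 1 (λ x → :- x :+ :- x := :- (x :+ x)) refl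

  lower-bound : ∀ x y → Σ Carrier λ m → m ≤ x × m ≤ y
  lower-bound x y with compare x y
  ... | tri< x<y _ _ = x , ≤-refl , <⇒≤ x<y
  ... | tri≈ _ refl _ = x , ≤-refl , ≤-refl
  ... | tri> _ _ y<x = y , <⇒≤ y<x , ≤-refl

  strict-lower-bound : ∀ x y → Σ Carrier λ m → m ≤ x × m < y
  strict-lower-bound x y =
    let m , m≤x , m≤y-1 = lower-bound x (y − 1#)
    in m , m≤x , ≤-<-trans m≤y-1 (0<⇒< (subst (0# <_) (solve 1 (λ y → :1 := y :- (y :- :1)) refl y) 0<1))

  -- Polynomial functions and division by x - r.

  -- Lead d f f′ k: f is a polynomial function of formal degree d with coefficient k at
  -- x^d (possibly zero), and f′ is its derivative.
  data Lead : ℕ → (f f′ : Carrier → Carrier) → Carrier → Set where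
    const : ∀ {f f′ k} → (∀ x → f x ≡ k) → (∀ x → f′ x ≡ 0#) → Lead 0 f f′ k
    horner : ∀ {d f f′ k} c g g′ → (∀ x → f x ≡ c + x * g x) →
      (∀ x → f′ x ≡ g x + x * g′ x) → Lead d g g′ k → Lead (suc d) f f′ k

  Lead-scale : ∀ {d f f′ k} a → Lead d f f′ k →
    Lead d (λ x → a * f x) (λ x → a * f′ x) (a * k)
  Lead-scale a (const eq eq′) =
    const (λ x → cong (a *_) (eq x)) (λ x → trans (cong (a *_) (eq′ x)) (CR.zeroʳ a))
  Lead-scale a (horner c g g′ eq eq′ G) = horner (a * c) (λ x → a * g x) (λ x → a * g′ x)
    (λ x → trans (cong (a *_) (eq x))
      (solve 4 (λ a c x y → a :* (c :+ x :* y) := a :* c :+ x :* (a :* y)) refl a c x (g x)))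
    (λ x → trans (cong (a *_) (eq′ x))
      (solve 4 (λ a y x z → a :* (y :+ x :* z) := a :* y :+ x :* (a :* z)) refl a (g x) x (g′ x)))
    (Lead-scale a G)

  Lead-add : ∀ {d f f′ k g g′ m} → Lead (suc d) f f′ k → Lead d g g′ m → ∀ a →
    Lead (suc d) (λ x → f x + a * g x) (λ x → f′ x + a * g′ x) k
  Lead-add {f = f} {f′} {k} {g} {g′} {m} (horner c h h′ eq eq′ H) (const e e′) a =
    horner (c + a * m) h h′
      (λ x → trans (cong₂ (λ u v → u + a * v) (eq x) (e x))
        (solve 5 (λ c x y a m → c :+ x :* y :+ a :* m := c :+ a :* m :+ x :* y) refl c x (h x) a m))
      (λ x → trans (cong₂ (λ u v → u + a * v) (eq′ x) (e′ x))
        (solve 2 (λ u a → u :+ a :* :0 := u) refl (h x + x * h′ x) a))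
      H
  Lead-add (horner c h h′ eq eq′ H) (horner c₂ h₂ h₂′ e e′ H₂) a =
    horner (c + a * c₂) (λ x → h x + a * h₂ x) (λ x → h′ x + a * h₂′ x)
      (λ x → trans (cong₂ (λ u v → u + a * v) (eq x) (e x))
        (solve 6 (λ c x y a c₂ z → c :+ x :* y :+ a :* (c₂ :+ x :* z)
          := c :+ a :* c₂ :+ x :* (y :+ a :* z)) refl c x (h x) a c₂ (h₂ x)))
      (λ x → trans (cong₂ (λ u v → u + a * v) (eq′ x) (e′ x))
        (solve 6 (λ x y y′ a z z′ → y :+ x :* y′ :+ a :* (z :+ x :* z′)
          := y :+ a :* z :+ x :* (y′ :+ a :* z′)) refl x (h x) (h′ x) a (h₂ x) (h₂′ x)))
      (Lead-add H H₂ a)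

  Lead-const-+ : ∀ {d f f′ k} a → Lead (suc d) f f′ k → Lead (suc d) (λ x → a + f x) f′ k
  Lead-const-+ a (horner c g g′ eq eq′ G) = horner (a + c) g g′
    (λ x → trans (cong (a +_) (eq x)) (sym (CR.+-assoc _ _ _))) eq′ G

  Lead-mul : ∀ {d f f′ k} r → Lead d f f′ k →
    Lead (suc d) (λ x → (x − r) * f x) (λ x → f x + (x − r) * f′ x) k
  Lead-mul {k = k} r (const eq eq′) = horner (- r * k) (λ _ → k) (λ _ → 0#)
    (λ x → trans (cong ((x − r) *_) (eq x))
      (solve 3 (λ x r k → (x :- r) :* k := :- r :* k :+ x :* k) refl x r k))
    (λ x → trans (cong₂ (λ u v → u + (x − r) * v) (eq x) (eq′ x))
      (solve 3 (λ x r k → k :+ (x :- r) :* :0 := k :+ x :* :0) refl x r k))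
    (const (λ _ → refl) (λ _ → refl))
  Lead-mul r (horner c g g′ eq eq′ G) =
    horner (- r * c) (λ x → c + (x − r) * g x) (λ x → g x + (x − r) * g′ x)
      (λ x → trans (cong ((x − r) *_) (eq x))
        (solve 4 (λ x r c y → (x :- r) :* (c :+ x :* y) := :- r :* c :+ x :* (c :+ (x :- r) :* y))
          refl x r c (g x)))
      (λ x → trans (cong₂ (λ u v → u + (x − r) * v) (eq x) (eq′ x))
        (solve 5 (λ x r c y z → c :+ x :* y :+ (x :- r) :* (y :+ x :* z)
          := c :+ (x :- r) :* y :+ x :* (y :+ (x :- r) :* z)) refl x r c (g x) (g′ x)))
      (Lead-const-+ c (Lead-mul r G))

  record Quotient (d : ℕ) (f f′ : Carrier → Carrier) (k r : Carrier) : Set where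
    field
      q q′ : Carrier → Carrier
      value : ∀ x → f x ≡ f r + (x − r) * q x
      slope : ∀ x → f′ x ≡ q x + (x − r) * q′ x
      lead : Lead d q q′ k

  divide : ∀ {d f f′ k} → Lead (suc d) f f′ k → ∀ r → Quotient d f f′ k r
  divide {k = k} (horner c g g′ eq eq′ (const e e′)) r = record
    { q = λ _ → k ; q′ = λ _ → 0#
    ; value = λ x → trans (eq x) (trans (cong (λ u → c + x * u) (e x))
        (trans (solve 4 (λ c x r k → c :+ x :* k := c :+ r :* k :+ (x :- r) :* k) refl c x r k)
          (cong (_+ (x − r) * k) (sym (trans (eq r) (cong (λ u → c + r * u) (e r)))))))
    ; slope = λ x → trans (eq′ x) (trans (cong₂ (λ u v → u + x * v) (e x) (e′ x))
        (solve 3 (λ x r k → k :+ x :* :0 := k :+ (x :- r) :* :0) refl x r k))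
    ; lead = const (λ _ → refl) (λ _ → refl) }
  divide (horner c g g′ eq eq′ G@(horner _ _ _ _ _ _)) r = record
    { q = λ x → g r + x * D.q x ; q′ = λ x → D.q x + x * D.q′ x
    ; value = λ x → trans (eq x) (trans (cong (λ u → c + x * u) (D.value x))
        (trans (solve 5 (λ c x r k y → c :+ x :* (k :+ (x :- r) :* y)
            := c :+ r :* k :+ (x :- r) :* (k :+ x :* y)) refl c x r (g r) (D.q x))
          (cong (_+ (x − r) * (g r + x * D.q x)) (sym (eq r)))))
    ; slope = λ x → trans (eq′ x) (trans (cong₂ (λ u v → u + x * v) (D.value x) (D.slope x))
        (solve 5 (λ x r k y z → k :+ (x :- r) :* y :+ x :* (y :+ (x :- r) :* z)
          := k :+ x :* y :+ (x :- r) :* (y :+ x :* z)) refl x r (g r) (D.q x) (D.q′ x)))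
    ; lead = horner (g r) D.q D.q′ (λ _ → refl) (λ _ → refl) D.lead }
    where module D = Quotient (divide G r)

  -- Continuity and the intermediate value theorem.

  Within : Carrier → Carrier → Set
  Within K a = - K ≤ a × a ≤ K

  -- (D - u)(K - h) + (u + D)(h + K) = 2 (u h + D K), and similarly for the upper bound; this spares
  -- all cases on signs.
  Within-* : ∀ {D K u h} → Within D u → Within K h → Within (D * K) (u * h)
  Within-* {D} {K} {u} {h} (-D≤u , u≤D) (-K≤h , h≤K) =
    0≤⇒≤ (halve-nonneg (subst (0# ≤_) (lower D K u h)
      (+-nonneg (*-nonneg (≤⇒0≤ u≤D) (≤⇒0≤ h≤K)) (*-nonneg (≤⇒0≤ -D≤u) (≤⇒0≤ -K≤h))))) ,
    0≤⇒≤ (halve-nonneg (subst (0# ≤_) (upper D K u h)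
      (+-nonneg (*-nonneg (≤⇒0≤ u≤D) (≤⇒0≤ -K≤h)) (*-nonneg (≤⇒0≤ -D≤u) (≤⇒0≤ h≤K)))))
    where
    lower : ∀ D K u h → (D − u) * (K − h) + (u − - D) * (h − - K)
      ≡ (u * h − - (D * K)) + (u * h − - (D * K))
    lower = solve 4 (λ D K u h → (D :- u) :* (K :- h) :+ (u :- :- D) :* (h :- :- K)
      := (u :* h :- :- (D :* K)) :+ (u :* h :- :- (D :* K))) refl
    upper : ∀ D K u h → (D − u) * (h − - K) + (u − - D) * (K − h)
      ≡ (D * K − u * h) + (D * K − u * h)
    upper = solve 4 (λ D K u h → (D :- u) :* (h :- :- K) :+ (u :- :- D) :* (K :- h)
      := (D :* K :- u :* h) :+ (D :* K :- u :* h)) refl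

  Within-+ : ∀ {D K u h} → Within D u → Within K h → Within (D + K) (u + h)
  Within-+ {D} {K} {u} {h} (-D≤u , u≤D) (-K≤h , h≤K) =
    0≤⇒≤ (subst (0# ≤_) (solve 4 (λ D K u h → (u :- :- D) :+ (h :- :- K) := u :+ h :- :- (D :+ K)) refl D K u h)
      (+-nonneg (≤⇒0≤ -D≤u) (≤⇒0≤ -K≤h))) ,
    0≤⇒≤ (subst (0# ≤_) (solve 4 (λ D K u h → (D :- u) :+ (K :- h) := D :+ K :- (u :+ h)) refl D K u h)
      (+-nonneg (≤⇒0≤ u≤D) (≤⇒0≤ h≤K)))

  magnitude : ∀ a → Σ Carrier λ K → 0# ≤ K × Within K a
  magnitude a with compare a 0#
  ... | tri< a<0 _ _ = - a , <⇒≤ (neg-pos a<0) , inj₂ (-‿involutive a) , <⇒≤ (<-trans a<0 (neg-pos a<0))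
  ... | tri≈ _ refl _ = 0# , ≤-refl , inj₂ -0#≈0# , ≤-refl
  ... | tri> _ _ 0<a = a , <⇒≤ 0<a , <⇒≤ (<-trans (pos-neg (subst (0# <_) (sym (-‿involutive a)) 0<a)) 0<a) , ≤-refl

  -- Induction on the degree through f(x) = f(c) + (x - c) q(x). Applied to the quotient q, it
  -- yields continuity of f at c.
  Lead-bounded : ∀ {d f f′ k} → Lead d f f′ k → ∀ c →
    Σ Carrier λ K → 0# ≤ K × (∀ x → Within 1# (x − c) → Within K (f x))
  Lead-bounded {k = k} (const eq _) c with magnitude k
  ... | K , 0≤K , w = K , 0≤K , λ x _ → subst (Within K) (sym (eq x)) w
  Lead-bounded {f = f} F@(horner _ _ _ _ _ _) c
    with magnitude (f c) | Lead-bounded (Quotient.lead (divide F c)) c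
  ... | K , 0≤K , w | L , 0≤L , v = K + 1# * L , +-nonneg 0≤K (*-nonneg (<⇒≤ 0<1) 0≤L) ,
    λ x near → subst (Within (K + 1# * L)) (sym (value x)) (Within-+ w (Within-* near (v x near)))
    where open Quotient (divide F c)

  Lead-positive-near : ∀ {d f f′ k} → Lead d f f′ k → ∀ c → 0# < f c →
    Σ Carrier λ δ → 0# < δ × (∀ x → Within δ (x − c) → 0# < f x)
  Lead-positive-near (const eq _) c 0<fc =
    1# , 0<1 , λ x _ → subst (0# <_) (trans (eq c) (sym (eq x))) 0<fc
  Lead-positive-near {f = f} F@(horner _ _ _ _ _ _) c 0<fc
    with Lead-bounded (Quotient.lead (divide F c)) c
  ... | K , 0≤K , bound with inverse-pos (+-pos 0<fc 0≤K)
  ... | t , Tt≡1 , 0<t = δ , *-pos 0<fc 0<t , positive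
    where
    open Quotient (divide F c)
    -- δ = f(c) / (f(c) + K): it is at most 1, so the bound K on the quotient applies, and f(c) - δ
    -- K = f(c)² / (f(c) + K) is still positive.
    δ = f c * t
    δ≤1 : δ ≤ 1#
    δ≤1 = 0≤⇒≤ (subst (0# ≤_) (trans (ring (f c) K t) (cong (_− f c * t) Tt≡1)) (*-nonneg 0≤K (<⇒≤ 0<t)))
      where
      ring : ∀ a K t → K * t ≡ (a + K) * t − a * t
      ring = solve 3 (λ a K t → K :* t := (a :+ K) :* t :- a :* t) refl
    gap : 0# < f c − δ * K
    gap = subst (0# <_)
        (trans (ring (f c) K t)
          (trans (cong (λ u → f c * u − δ * K) Tt≡1) (cong (_− δ * K) (CR.*-identityʳ _))))
        (*-pos 0<fc (*-pos 0<fc 0<t))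
      where
      ring : ∀ a K t → a * (a * t) ≡ a * ((a + K) * t) − a * t * K
      ring = solve 3 (λ a K t → a :* (a :* t) := a :* ((a :+ K) :* t) :- a :* t :* K) refl
    positive : ∀ x → Within δ (x − c) → 0# < f x
    positive x near@(-δ≤u , u≤δ) = subst (0# <_) (sym eq)
      (+-pos gap (≤⇒0≤ (proj₁ (Within-* near (bound x (≤-trans -1≤-δ -δ≤u , ≤-trans u≤δ δ≤1))))))
      where
      -1≤-δ : - 1# ≤ - δ
      -1≤-δ = 0≤⇒≤ (subst (0# ≤_) (solve 2 (λ a b → a :- b := :- b :- :- a) refl 1# δ) (≤⇒0≤ δ≤1))
      eq : f x ≡ f c − δ * K + ((x − c) * q x − - (δ * K))
      eq = trans (value x) (solve 3 (λ a b e → a :+ b := a :- e :+ (b :- :- e)) refl (f c) ((x − c) * q x) (δ * K))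

  Lead-negative-near : ∀ {d f f′ k} → Lead d f f′ k → ∀ c → f c < 0# →
    Σ Carrier λ δ → 0# < δ × (∀ x → Within δ (x − c) → f x < 0#)
  Lead-negative-near {f = f} F c fc<0
    with Lead-positive-near (Lead-scale (- 1#) F) c (subst (0# <_) (ring (f c)) (neg-pos fc<0))
    where
    ring : ∀ a → - a ≡ - 1# * a
    ring = solve 1 (λ a → :- a := :- :1 :* a) refl
  ... | δ , 0<δ , pos = δ , 0<δ , λ x near → pos-neg (subst (0# <_) (ring (f x)) (pos x near))
    where
    ring : ∀ a → - 1# * a ≡ - a
    ring = solve 1 (λ a → :- :1 :* a := :- a) refl

  x−x : ∀ x → x − x ≡ 0#
  x−x = CR.-‿inverseʳ

  -- The zero is the supremum s of the points of [a, b] with f ≤ 0. If f(s) < 0, a larger such point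
  -- exists or f(b) < 0; if f(s) > 0, s - δ is a smaller upper bound.
  intermediate-value : ∀ {d f f′ k} → Lead d f f′ k → ∀ {a b} → a < b → f a < 0# → 0# < f b →
    Σ Carrier λ r → a < r × r < b × f r ≡ 0#
  intermediate-value {f = f} F {a} {b} a<b fa<0 0<fb = result
    where
    P : Carrier → Set
    P x = a ≤ x × x ≤ b × f x ≤ 0#
    Pa : P a
    Pa = ≤-refl , <⇒≤ a<b , <⇒≤ fa<0
    S = sup P (a , Pa) (b , λ x (_ , x≤b , _) → x≤b)
    s = proj₁ S
    upper = proj₁ (proj₂ S)
    least = proj₂ (proj₂ S)
    a≤s : a ≤ s
    a≤s = upper a Pa
    s≤b : s ≤ b
    s≤b = least b (λ x (_ , x≤b , _) → x≤b)
    s-near : ∀ {δ x} → 0# < δ → s − δ ≤ x → x ≤ s + δ → Within δ (x − s)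
    s-near {δ} {x} 0<δ l u =
      0≤⇒≤ (subst (0# ≤_) (solve 3 (λ x s δ → x :- (s :- δ) := x :- s :- :- δ) refl x s δ) (≤⇒0≤ l)) ,
      0≤⇒≤ (subst (0# ≤_) (solve 3 (λ x s δ → s :+ δ :- x := δ :- (x :- s)) refl x s δ) (≤⇒0≤ u))
    s<s+ : ∀ {δ} → 0# < δ → s < s + δ
    s<s+ {δ} 0<δ = 0<⇒< (subst (0# <_) (solve 2 (λ s δ → δ := s :+ δ :- s) refl s δ) 0<δ)
    s-<s : ∀ {δ} → 0# < δ → s − δ < s
    s-<s {δ} 0<δ = 0<⇒< (subst (0# <_) (solve 2 (λ s δ → δ := s :- (s :- δ)) refl s δ) 0<δ)
    not-negative : ¬ (f s < 0#)
    not-negative fs<0 with Lead-negative-near F s fs<0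
    ... | δ , 0<δ , neg with compare (s + δ) b
    ... | tri< lt _ _ = ≤⇒≯ (upper (s + δ) (≤-trans a≤s (<⇒≤ (s<s+ 0<δ)) , <⇒≤ lt ,
            <⇒≤ (neg (s + δ) (s-near 0<δ (<⇒≤ (<-trans (s-<s 0<δ) (s<s+ 0<δ))) ≤-refl)))) (s<s+ 0<δ)
    ... | tri≈ _ eq _ = <-irrefl refl (<-trans 0<fb
            (neg b (s-near 0<δ (≤-trans (<⇒≤ (s-<s 0<δ)) s≤b) (inj₂ (sym eq)))))
    ... | tri> _ _ gt = <-irrefl refl (<-trans 0<fb
            (neg b (s-near 0<δ (≤-trans (<⇒≤ (s-<s 0<δ)) s≤b) (<⇒≤ gt))))
    not-positive : ¬ (0# < f s)
    not-positive 0<fs with Lead-positive-near F s 0<fs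
    ... | δ , 0<δ , pos = ≤⇒≯ (least (s − δ) λ x (a≤x , x≤b , fx≤0) → ≮⇒≥ λ s-δ<x →
            ≤⇒≯ fx≤0 (pos x (s-near 0<δ (<⇒≤ s-δ<x)
              (≤-trans (upper x (a≤x , x≤b , fx≤0)) (<⇒≤ (s<s+ 0<δ)))))) (s-<s 0<δ)
    strict : ∀ {x y} → x ≤ y → f x ≢ f y → x < y
    strict (inj₁ lt) _ = lt
    strict (inj₂ refl) ne = ⊥-elim (ne refl)
    result : Σ Carrier λ r → a < r × r < b × f r ≡ 0#
    result with compare (f s) 0#
    ... | tri< lt _ _ = ⊥-elim (not-negative lt)
    ... | tri> _ _ gt = ⊥-elim (not-positive gt)
    ... | tri≈ _ eq _ = s ,
          strict a≤s (λ fa≡fs → <⇒≢ fa<0 (trans fa≡fs eq)) ,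
          strict s≤b (λ fs≡fb → <⇒≢ 0<fb (trans (sym eq) fs≡fb)) , eq

  root-between : ∀ {d f f′ k} → Lead d f f′ k → ∀ s {a b} → a < b → 0# < - s * f a → 0# < s * f b →
    Σ Carrier λ r → a < r × r < b × f r ≡ 0#
  root-between {f = f} F s {a} {b} a<b fa fb
    with intermediate-value (Lead-scale s F) a<b
           (pos-neg (subst (0# <_) (sym (-‿distribˡ-* s (f a))) fa)) fb
  ... | r , a<r , r<b , sfr≡0 = r , a<r , r<b , *-zero-cancel (*-pos⇒≢0ˡ fb) sfr≡0

  -- Signs at -∞.

  -- A uniform bound δ is required, not mere positivity: in a Horner step - x times the function
  -- must outweigh a constant.
  EventuallyPos : (Carrier → Carrier) → Set
  EventuallyPos f = Σ Carrier λ M → Σ Carrier λ δ → 0# < δ × (∀ x → x ≤ M → δ ≤ f x)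

  -- (-1)ⁿ s, with the sign passed on as in `Alt`, so that the recursion in `roots` needs no
  -- conversion.
  alternate : Carrier → ℕ → Carrier
  alternate s zero = s
  alternate s (suc n) = alternate (- s) n

  alternate-neg : ∀ s n → alternate (- s) n ≡ - alternate s n
  alternate-neg s zero = refl
  alternate-neg s (suc n) = alternate-neg (- s) n

  EventuallyPos-horner : ∀ {g} → EventuallyPos g → ∀ c → EventuallyPos (λ x → c + - x * g x)
  EventuallyPos-horner {g} (M , δ , 0<δ , lower) c with inverse-pos 0<δ
  ... | t , δt≡1 , 0<t with lower-bound M 0#
  -- For x ≤ (c - 1) / δ one has c - x δ ≥ 1, which makes 1 the new uniform bound.
  ... | m , m≤M , m≤0 with lower-bound m ((c − 1#) * t)
  ... | m′ , m′≤m , m′≤ct = m′ , 1# , 0<1 , λ x x≤m′ →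
    let x≤m = ≤-trans x≤m′ m′≤m in
    0≤⇒≤ (subst (0# ≤_) (ring c x (g x) δ)
      (+-nonneg
        (*-nonneg (neg-nonneg (≤-trans x≤m m≤0)) (≤⇒0≤ (lower x (≤-trans x≤m m≤M))))
        (subst (0# ≤_) (trans (ring₁ c x t δ)
            (trans (cong (λ u → u * (c − 1#) − x * δ) δt≡1) (cong (_− x * δ) (CR.*-identityˡ _))))
          (*-nonneg (≤⇒0≤ (≤-trans x≤m′ m′≤ct)) (<⇒≤ 0<δ)))))
    where
    ring : ∀ c x y δ → - x * (y − δ) + (c − 1# − x * δ) ≡ c + - x * y − 1#
    ring = solve 4 (λ c x y δ → :- x :* (y :- δ) :+ (c :- :1 :- x :* δ) := c :+ :- x :* y :- :1) refl
    ring₁ : ∀ c x t δ → ((c − 1#) * t − x) * δ ≡ δ * t * (c − 1#) − x * δ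
    ring₁ = solve 4 (λ c x t δ → ((c :- :1) :* t :- x) :* δ := δ :* t :* (c :- :1) :- x :* δ) refl

  EventuallyPos-cong : ∀ {f g} → (∀ x → f x ≡ g x) → EventuallyPos f → EventuallyPos g
  EventuallyPos-cong eq (M , δ , 0<δ , lower) = M , δ , 0<δ , λ x x≤M → subst (δ ≤_) (eq x) (lower x x≤M)

  sign-at-−∞ : ∀ {d f f′ k} → Lead d f f′ k → ∀ s → 0# < s * k → EventuallyPos (λ x → alternate s d * f x)
  sign-at-−∞ (const eq _) s 0<sk = 0# , _ , 0<sk , λ x _ → inj₂ (cong (s *_) (sym (eq x)))
  sign-at-−∞ {suc d} {f} (horner c g g′ eq _ G) s 0<sk =
    EventuallyPos-cong
      (λ x → sym (trans (cong₂ _*_ (alternate-neg s d) (eq x)) (ring (alternate s d) c x (g x))))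
      (EventuallyPos-horner (sign-at-−∞ G s 0<sk) (- alternate s d * c))
    where
    ring : ∀ a c x y → - a * (c + x * y) ≡ - a * c + - x * (a * y)
    ring = solve 4 (λ a c x y → :- a :* (c :+ x :* y) := :- a :* c :+ :- x :* (a :* y)) refl

  -- Products over distinct zeros.

  ∏ ∏′ : List Carrier → Carrier → Carrier
  ∏ rs x = prod R (map (λ r → x − r) rs)
  ∏′ [] x = 0#
  ∏′ (r ∷ rs) x = ∏ rs x + (x − r) * ∏′ rs x

  Lead-∏ : ∀ rs → Lead (length rs) (∏ rs) (∏′ rs) 1#
  Lead-∏ [] = const (λ _ → refl) (λ _ → refl)
  Lead-∏ (r ∷ rs) = Lead-mul r (Lead-∏ rs)

  Desc : List Carrier → Set
  Desc = AllPairs (λ x y → y < x)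

  ∏-pos : ∀ {rs x} → All (_< x) rs → 0# < ∏ rs x
  ∏-pos [] = 0<1
  ∏-pos (r<x ∷ rs<x) = *-pos (<⇒0< r<x) (∏-pos rs<x)

  ∏-root : ∀ rs → All (λ r → ∏ rs r ≡ 0#) rs
  ∏-root [] = []
  ∏-root (r ∷ rs) = trans (cong (_* ∏ rs r) (x−x r)) (CR.zeroˡ _) ∷
    All.map (λ {x} eq → trans (cong ((x − r) *_) eq) (CR.zeroʳ _)) (∏-root rs)

  -- Dividing by x - r keeps the remaining zeros, which differ from r because the list is strictly
  -- descending. The derivative is factored along with f.
  factorisation : ∀ {d f f′ k} → Lead d f f′ k → ∀ rs → length rs ≡ d → Desc rs →
    All (λ r → f r ≡ 0#) rs → (∀ x → f x ≡ k * ∏ rs x) × (∀ x → f′ x ≡ k * ∏′ rs x)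
  factorisation {k = k} (const eq eq′) [] refl [] [] =
    (λ x → trans (eq x) (sym (CR.*-identityʳ k))) , λ x → trans (eq′ x) (sym (CR.zeroʳ k))
  factorisation {f = f} {k = k} F@(horner _ _ _ _ _ _) (r ∷ rs) refl (rs<r ∷ desc) (fr≡0 ∷ roots) =
    (λ x → trans (split x) (trans (cong ((x − r) *_) (proj₁ ih x))
      (solve 3 (λ u k p → u :* (k :* p) := k :* (u :* p)) refl (x − r) k (∏ rs x)))) ,
    λ x → trans (slope x) (trans (cong₂ (λ u v → u + (x − r) * v) (proj₁ ih x) (proj₂ ih x))
      (solve 4 (λ u k p p′ → k :* p :+ u :* (k :* p′) := k :* (p :+ u :* p′)) refl
        (x − r) k (∏ rs x) (∏′ rs x)))
    where
    open Quotient (divide F r)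
    split : ∀ x → f x ≡ (x − r) * q x
    split x = trans (value x) (trans (cong (_+ (x − r) * q x) fr≡0) (CR.+-identityˡ _))
    ih = factorisation lead rs refl desc
      (All.zipWith (λ {y} (y<r , fy≡0) →
        *-zero-cancel (λ eq → pos⇒≢0 (<⇒0< y<r)
          (trans (solve 2 (λ r y → r :- y := :- (y :- r)) refl r y) (trans (cong -_ eq) -0#≈0#)))
          (trans (sym (split y)) fy≡0)) (rs<r , roots))

  -- Alternating signs along a descending list.

  Alt : Carrier → (Carrier → Carrier) → List Carrier → Set
  Alt s f [] = ⊤
  Alt s f (x ∷ xs) = 0# < s * f x × Alt (- s) f xs

  Alt-zip : ∀ {f g h xs} → All (λ x → ∀ s → 0# < s * g x → 0# < s * h x → 0# < s * f x) xs →
    ∀ {s} → Alt s g xs → Alt s h xs → Alt s f xs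
  Alt-zip [] _ _ = tt
  Alt-zip (imp ∷ imps) (g , gs) (h , hs) = imp _ g h , Alt-zip imps gs hs

  Alt-map : ∀ {f g xs} → All (λ x → ∀ s → 0# < s * g x → 0# < s * f x) xs →
    ∀ {s} → Alt s g xs → Alt s f xs
  Alt-map imps gs = Alt-zip (All.map (λ imp s g _ → imp s g) imps) gs gs

  Alt-scale : ∀ {f g ℓ s xs} → 0# < ℓ → (∀ x → f x ≡ ℓ * g x) → Alt s g xs → Alt s f xs
  Alt-scale {f} {g} {ℓ} 0<ℓ eq = Alt-map (All.universal (λ x s pos → subst (0# <_)
    (trans (solve 3 (λ l s y → l :* (s :* y) := s :* (l :* y)) refl ℓ s (g x)) (cong (s *_) (sym (eq x))))
    (*-pos 0<ℓ pos)) _)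

  Alt-≢0 : ∀ {f s xs} → Alt s f xs → All (λ x → f x ≢ 0#) xs
  Alt-≢0 {xs = []} _ = []
  Alt-≢0 {xs = x ∷ xs} (p , ps) = *-pos⇒≢0ʳ p ∷ Alt-≢0 ps

  same-sign : ∀ {g f} s → 0# < g * f → 0# < s * g → 0# < s * f
  same-sign {g} {f} s 0<gf 0<sg = *-cancel-pos (square-pos (*-pos⇒≢0ʳ 0<sg))
    (subst (0# <_) (solve 3 (λ s g f → s :* g :* (g :* f) := g :* g :* (s :* f)) refl s g f) (*-pos 0<sg 0<gf))

  Alt-multiply : ∀ {p f s xs} → All (_< p) xs → Alt s f xs → Alt (- s) (λ x → (x − p) * f x) xs
  Alt-multiply [] _ = tt
  Alt-multiply {p} {f} {s} {x ∷ xs} (x<p ∷ xs<p) (pos , alt) =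
    subst (0# <_) (solve 4 (λ p x s y → (p :- x) :* (s :* y) := :- s :* ((x :- p) :* y)) refl p x s (f x))
      (*-pos (<⇒0< x<p) pos) , Alt-multiply xs<p alt

  Alt-divide : ∀ {p f s xs} → All (_< p) xs → Alt (- s) (λ x → (x − p) * f x) xs → Alt s f xs
  Alt-divide [] _ = tt
  Alt-divide {p} {f} {s} {x ∷ xs} (x<p ∷ xs<p) (pos , alt) =
    *-cancel-pos (<⇒0< x<p) (subst (0# <_)
      (solve 4 (λ p x s y → :- s :* ((x :- p) :* y) := (p :- x) :* (s :* y)) refl p x s (f x)) pos) ,
    Alt-divide xs<p alt

  -- At the i-th zero the derivative is the product of the differences to the other zeros, of which
  -- exactly i - 1 are negative.
  Alt-∏′ : ∀ {rs} → Desc rs → Alt 1# (∏′ rs) rs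
  Alt-∏′ [] = tt
  Alt-∏′ {r ∷ rs} (rs<r ∷ desc) =
    subst (0# <_) (solve 3 (λ p r p′ → p := :1 :* (p :+ (r :- r) :* p′)) refl (∏ rs r) r (∏′ rs r)) (∏-pos rs<r) ,
    Alt-map (All.map (λ {x} eq s → subst (λ y → 0# < s * y)
        (sym (trans (cong (_+ (x − r) * ∏′ rs x) eq) (CR.+-identityˡ _)))) (∏-root rs))
      (Alt-multiply rs<r (Alt-∏′ desc))

  -- By partial fractions O/E = Σ cᵢ/(x − eᵢ) + const with cᵢ > 0, peeled off one root at a
  -- time; each term contributes −c (x + e) (E/(x − e))².
  wronskian-nonneg : ∀ es {O O′ k} → Lead (length es) O O′ k → 0# ≤ k → Desc es → All (_≤ 0#) es →
    Alt 1# O es → ∀ x → x ≤ 0# →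
    0# ≤ O x * ∏ es x + (x + x) * (O′ x * ∏ es x − O x * ∏′ es x)
  wronskian-nonneg [] {k = k} (const eq eq′) 0≤k _ _ _ x _ = subst (0# ≤_)
    (trans (solve 2 (λ k x → k := k :* :1 :+ (x :+ x) :* (:0 :* :1 :- k :* :0)) refl k x)
      (sym (cong₂ (λ u v → u * 1# + (x + x) * (v * 1# − u * 0#)) (eq x) (eq′ x)))) 0≤k
  wronskian-nonneg (e ∷ es) {O} {O′} {k} F 0≤k (es<e ∷ desc) (e≤0 ∷ es≤0) (Oe , alt) x x≤0 =
    subst (0# ≤_) (sym (trans
        (cong₂ (λ u v → u * ((x − e) * S) + (x + x) * (v * ((x − e) * S) − u * (S + (x − e) * S′)))
          (O≡ x) O′≡)
        (trans
          (cong (λ u → (c * S + (x − e) * q x) * ((x − e) * S) + (x + x) * u)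
            (ring₁ (x − e) c S S′ (q x) (q′ x)))
          (ring₂ x e c S (q x) (q′ x * S − q x * S′)))))
      (+-nonneg (*-nonneg (*-nonneg (<⇒≤ 0<c) (square-nonneg S)) (+-nonneg (neg-nonneg x≤0) (neg-nonneg e≤0)))
        (*-nonneg (square-nonneg (x − e)) ih))
    where
    S = ∏ es x
    S′ = ∏′ es x
    inv = inverse-pos (∏-pos es<e)
    t = proj₁ inv
    -- The residue of O / E at e; positive, since e is the largest zero, where O is positive.
    c = O e * t
    0<c : 0# < c
    0<c = *-pos (subst (0# <_) (CR.*-identityˡ (O e)) Oe) (proj₂ (proj₂ inv))
    -- The subtracted product has lower degree, so k survives every peeling and ends up as the
    -- constant of the partial fractions.
    open Quotient (divide (Lead-add F (Lead-∏ es) (- c)) e)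
    residue : O e + - c * ∏ es e ≡ 0#
    residue = trans (solve 3 (λ o t p → o :+ :- (o :* t) :* p := o :- o :* (p :* t)) refl (O e) t (∏ es e))
      (trans (cong (λ u → O e − O e * u) (proj₁ (proj₂ inv))) (solve 1 (λ o → o :- o :* :1 := :0) refl (O e)))
    O≡ : ∀ y → O y ≡ c * ∏ es y + (y − e) * q y
    O≡ y = trans (solve 3 (λ o c p → o := c :* p :+ (o :+ :- c :* p)) refl (O y) c (∏ es y))
      (cong (c * ∏ es y +_) (trans (value y) (trans (cong (_+ (y − e) * q y) residue) (CR.+-identityˡ _))))
    O′≡ : O′ x ≡ c * S′ + (q x + (x − e) * q′ x)
    O′≡ = trans (solve 3 (λ o c p → o := c :* p :+ (o :+ :- c :* p)) refl (O′ x) c S′)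
      (cong (c * S′ +_) (slope x))
    -- At the other zeros `∏ es` vanishes and O = (x - e) q; dividing by the negative x - e turns
    -- signs starting with - 1 into signs starting with 1.
    ih = wronskian-nonneg es lead 0≤k desc es≤0
      (Alt-divide es<e (Alt-map (All.map (λ {y} eq s → subst (λ z → 0# < s * z)
          (trans (O≡ y) (trans (cong (λ u → c * u + (y − e) * q y) eq)
            (solve 2 (λ c z → c :* :0 :+ z := z) refl c ((y − e) * q y))))) (∏-root es)) alt)) x x≤0
    ring₁ : ∀ d c S S′ q q′ →
      (c * S′ + (q + d * q′)) * (d * S) − (c * S + d * q) * (S + d * S′)
      ≡ d * d * (q′ * S − q * S′) − c * (S * S)
    ring₁ = solve 6 (λ d c S S′ q q′ →
      (c :* S′ :+ (q :+ d :* q′)) :* (d :* S) :- (c :* S :+ d :* q) :* (S :+ d :* S′)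
      := d :* d :* (q′ :* S :- q :* S′) :- c :* (S :* S)) refl
    ring₂ : ∀ x e c S q z →
      (c * S + (x − e) * q) * ((x − e) * S) + (x + x) * ((x − e) * (x − e) * z − c * (S * S))
      ≡ c * (S * S) * (- x + - e) + (x − e) * (x − e) * (q * S + (x + x) * z)
    ring₂ = solve 6 (λ x e c S q z →
      (c :* S :+ (x :- e) :* q) :* ((x :- e) :* S) :+ (x :+ x) :* ((x :- e) :* (x :- e) :* z :- c :* (S :* S))
      := c :* (S :* S) :* (:- x :+ :- e) :+ (x :- e) :* (x :- e) :* (q :* S :+ (x :+ x) :* z)) refl

  -- Zeros located by sign changes.

  -- Sep p ps rs: p > r₁ > p₁ > r₂ > p₂ > ⋯, possibly with one more r below the last p.
  data Sep : Carrier → List Carrier → List Carrier → Set where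
    done : ∀ {p} → Sep p [] []
    extra : ∀ {p r} → r < p → Sep p [] (r ∷ [])
    next : ∀ {p q ps r rs} → q < r → r < p → Sep q ps rs → Sep p (q ∷ ps) (r ∷ rs)

  Sep-below : ∀ {p ps rs} → Sep p ps rs → All (_< p) rs
  Sep-below done = []
  Sep-below (extra r<p) = r<p ∷ []
  Sep-below (next q<r r<p sep) = r<p ∷ All.map (λ x<q → <-trans x<q (<-trans q<r r<p)) (Sep-below sep)

  Sep-Desc : ∀ {p ps rs} → Sep p ps rs → Desc rs
  Sep-Desc done = []
  Sep-Desc (extra r<p) = [] ∷ []
  Sep-Desc (next q<r r<p sep) = All.map (λ x<q → <-trans x<q q<r) (Sep-below sep) ∷ Sep-Desc sep

  Alt-∏-Sep : ∀ {p ps rs} → Desc (p ∷ ps) → Sep p ps rs → Alt (- 1#) (∏ (p ∷ ps)) rs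
  Alt-∏-Sep _ done = tt
  Alt-∏-Sep {p} _ (extra {r = r} r<p) = subst (0# <_)
    (solve 2 (λ p r → p :- r := :- :1 :* ((r :- p) :* :1)) refl p r) (<⇒0< r<p) , tt
  Alt-∏-Sep {p} {q ∷ ps} (_ ∷ desc@(ps<q ∷ _)) (next {r = r} q<r r<p sep) =
    subst (0# <_) (solve 3 (λ p r y → (p :- r) :* y := :- :1 :* ((r :- p) :* y)) refl p r (∏ (q ∷ ps) r))
      (*-pos (<⇒0< r<p) (∏-pos (q<r ∷ All.map (λ x<q → <-trans x<q q<r) ps<q))) ,
    Alt-multiply (All.map (λ x<q → <-trans x<q (<-trans q<r r<p)) (Sep-below sep)) (Alt-∏-Sep desc sep)

  -- One zero in each gap; for c = true the sign at -∞ differs from the sign at the lowest point,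
  -- which gives one more zero below it.
  roots : ∀ {d f f′ k} → Lead d f f′ k → ∀ c s p ps → Desc (p ∷ ps) → Alt s f (p ∷ ps) →
    (c ≡ true → EventuallyPos (λ x → alternate s (suc (length ps)) * f x)) →
    Σ (List Carrier) λ rs → Sep p ps rs × All (λ r → f r ≡ 0#) rs × length rs ≡ 𝟙 c ℕ.+ length ps
  roots F false s p [] _ _ _ = [] , done , [] , refl
  roots F true s p [] _ (pos , _) end =
    let M , δ , 0<δ , lower = end refl
        m , m≤M , m<p = strict-lower-bound M p
        r , _ , r<p , fr≡0 = root-between F s m<p (<-≤-trans 0<δ (lower m m≤M)) pos
    in r ∷ [] , extra r<p , fr≡0 ∷ [] , refl
  roots F c s p (q ∷ ps) ((q<p ∷ _) ∷ desc) (pos , alt@(neg , _)) end =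
    let r , q<r , r<p , fr≡0 = root-between F s q<p neg pos
        rs , sep , zeros , len = roots F c (- s) q ps desc alt end
    in r ∷ rs , next q<r r<p sep , fr≡0 ∷ zeros , trans (cong suc len) (sym (ℕ.+-suc (𝟙 c) (length ps)))

  record Separated (c : Bool) (f f′ : Carrier → Carrier) (k p : Carrier) (ps : List Carrier) : Set where
    field
      rs : List Carrier
      sep : Sep p ps rs
      size : length rs ≡ 𝟙 c ℕ.+ length ps
      zeros : All (λ r → f r ≡ 0#) rs
      value : ∀ x → f x ≡ k * ∏ rs x
      slope : ∀ x → f′ x ≡ k * ∏′ rs x

  abstract
    -- The zeros found are as many as the degree, hence all of them. This serves for B in the
    -- induction step and for O at the end.
    separate : ∀ c {f f′ k p ps} → Lead (𝟙 c ℕ.+ length ps) f f′ k → 0# < k → Desc (p ∷ ps) →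
      Alt 1# f (p ∷ ps) → Separated c f f′ k p ps
    separate c {k = k} {p} {ps} F 0<k desc alt =
      let rs , sep , zeros , len = roots F c 1# p ps desc alt
            λ { refl → sign-at-−∞ F 1# (subst (0# <_) (sym (CR.*-identityˡ k)) 0<k) }
          value , slope = factorisation F rs len (Sep-Desc sep) zeros
      in record { rs = rs ; sep = sep ; size = len ; zeros = zeros ; value = value ; slope = slope }

  -- Evaluation of integer polynomials and of the recurrences.

  ev : Poly → Carrier → Carrier
  ev = eval R

  ev-⊕ : ∀ p q x → ev (p ⊕ q) x ≡ ev p x + ev q x
  ev-⊕ [] q x = sym (CR.+-identityˡ _)
  ev-⊕ (a ∷ p) [] x = sym (CR.+-identityʳ _)
  ev-⊕ (a ∷ p) (b ∷ q) x = trans (cong₂ (λ u v → u + x * v) (ιᶻ-+ a b) (ev-⊕ p q x))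
    (solve 5 (λ a b x u v → a :+ b :+ x :* (u :+ v) := a :+ x :* u :+ (b :+ x :* v)) refl
      (ιᶻ a) (ιᶻ b) x (ev p x) (ev q x))

  ev-scale : ∀ c p x → ev (scale c p) x ≡ ιᶻ c * ev p x
  ev-scale c [] x = sym (CR.zeroʳ _)
  ev-scale c (a ∷ p) x = trans (cong₂ (λ u v → u + x * v) (ιᶻ-* c a) (ev-scale c p x))
    (solve 4 (λ c a x u → c :* a :+ x :* (c :* u) := c :* (a :+ x :* u)) refl (ιᶻ c) (ιᶻ a) x (ev p x))

  ev-zero : ∀ p → (∀ k → coeff p k ≡ ℤ.+ 0) → ∀ x → ev p x ≡ 0#
  ev-zero [] _ x = refl
  ev-zero (a ∷ p) z x = trans (cong₂ (λ u v → ιᶻ u + x * v) (z 0) (ev-zero p (λ k → z (suc k)) x))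
    (solve 1 (λ x → :0 :+ x :* :0 := :0) refl x)

  ev-cong : ∀ p q → p ≈ₚ q → ∀ x → ev p x ≡ ev q x
  ev-cong [] q eq x = sym (ev-zero q (λ k → sym (eq k)) x)
  ev-cong (a ∷ p) [] eq x = ev-zero (a ∷ p) eq x
  ev-cong (a ∷ p) (b ∷ q) eq x =
    cong₂ (λ u v → ιᶻ u + x * v) (eq 0) (ev-cong p q (λ k → eq (suc k)) x)

  ev-derivAux : ∀ m p x → ev (derivAux (suc m) p) x ≡ ev p x + ev (derivAux m p) x
  ev-derivAux m [] x = sym (CR.+-identityˡ 0#)
  ev-derivAux m (a ∷ p) x = trans
    (cong₂ (λ u v → u + x * v) (ιᶻ-* (ℤ.+ suc m) a) (ev-derivAux (suc m) p x))
    (trans (solve 5 (λ m a x u v → (:1 :+ m) :* a :+ x :* (u :+ v) := a :+ x :* u :+ (m :* a :+ x :* v)) refl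
        (ι m) (ιᶻ a) x (ev p x) (ev (derivAux (suc m) p) x))
      (cong (λ u → ιᶻ a + x * ev p x + (u + x * ev (derivAux (suc m) p) x)) (sym (ιᶻ-* (ℤ.+ m) a))))

  ev-deriv : ∀ a p x → ev (deriv (a ∷ p)) x ≡ ev p x + x * ev (deriv p) x
  ev-deriv a [] x = solve 1 (λ x → :0 := :0 :+ x :* :0) refl x
  ev-deriv a (b ∷ p) x = trans (ev-derivAux 0 (b ∷ p) x)
    (cong (ev (b ∷ p) x +_) (trans (cong (_+ x * ev (derivAux 1 p) x) (ιᶻ-* (ℤ.+ 0) b))
      (solve 2 (λ b u → :0 :* b :+ u := u) refl (ιᶻ b) (x * ev (derivAux 1 p) x))))

  Lead-ev : ∀ d p → (∀ k → d ℕ.< k → coeff p k ≡ ℤ.+ 0) →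
    Lead d (ev p) (ev (deriv p)) (ιᶻ (coeff p d))
  Lead-ev zero [] z = const (λ _ → refl) (λ _ → refl)
  Lead-ev zero (a ∷ p) z = const
    (λ x → trans (cong (λ u → ιᶻ a + x * u) (p≡0 x)) (solve 2 (λ a x → a :+ x :* :0 := a) refl (ιᶻ a) x))
    (λ x → trans (ev-deriv a p x) (trans (cong₂ (λ u v → u + x * v) (p≡0 x) (p′≡0 x))
      (solve 1 (λ x → :0 :+ x :* :0 := :0) refl x)))
    where
    p≡0 = ev-zero p (λ k → z (suc k) (ℕ.s≤s ℕ.z≤n))
    p′≡0 = ev-zero (deriv p) (λ k → trans (coeff-deriv p k)
      (trans (cong (ℤ.+ suc k ℤ.*_) (z (suc (suc k)) (ℕ.s≤s ℕ.z≤n))) (ℤ.*-zeroʳ (ℤ.+ suc k))))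
  Lead-ev (suc d) [] z = horner 0# (ev []) (ev [])
    (λ x → solve 1 (λ x → :0 := :0 :+ x :* :0) refl x)
    (λ x → solve 1 (λ x → :0 := :0 :+ x :* :0) refl x) (Lead-ev d [] (λ _ _ → refl))
  Lead-ev (suc d) (a ∷ p) z = horner (ιᶻ a) (ev p) (ev (deriv p)) (λ _ → refl) (ev-deriv a p)
    (Lead-ev d p (λ k d<k → z (suc k) (ℕ.s≤s d<k)))

  E E′ O O′ : ℕ → Carrier → Carrier
  E n = ev (TE n)
  E′ n = ev (deriv (TE n))
  O n = ev (TO n)
  O′ n = ev (deriv (TO n))

  ev-2x[1-x] : ∀ p x → ev (scale (ℤ.+ 2) (mulX (mul1mX p))) x ≡ (x + x) * ((1# − x) * ev p x)
  ev-2x[1-x] p x = trans (ev-scale (ℤ.+ 2) (mulX (mul1mX p)) x)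
    (trans (cong (λ u → ι 2 * (0# + x * u)) (trans (ev-⊕ p _ x)
        (cong (ev p x +_) (ev-scale ℤ.-[1+ 0 ] (mulX p) x))))
      (solve 2 (λ x u → (:1 :+ (:1 :+ :0)) :* (:0 :+ x :* (u :+ :- (:1 :+ :0) :* (:0 :+ x :* u)))
        := (x :+ x) :* ((:1 :- x) :* u)) refl x (ev p x)))

  E-rec : ∀ n x → E (suc (suc n)) x ≡
    ι (suc n) * (x * E (suc n) x) + (x + x) * ((1# − x) * E′ (suc n) x) + x * O (suc n) x
  E-rec n x = begin
    E (suc (suc n)) x
      ≡⟨ ev-cong (TE (suc (suc n))) (RHS-E (suc n)) (TE-rec n) x ⟩
    ev (RHS-E (suc n)) x
      ≡⟨ ev-⊕ A (B ⊕ C) x ⟩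
    ev A x + ev (B ⊕ C) x
      ≡⟨ cong₂ _+_ (ev-scale (ℤ.+ suc n) (mulX (TE (suc n))) x)
           (trans (ev-⊕ B C x) (cong (_+ ev C x) (ev-2x[1-x] (deriv (TE (suc n))) x))) ⟩
    ι (suc n) * (0# + x * E (suc n) x) + ((x + x) * ((1# − x) * E′ (suc n) x) + (0# + x * O (suc n) x))
      ≡⟨ solve 4 (λ n u v w → n :* (:0 :+ u) :+ (v :+ (:0 :+ w)) := n :* u :+ v :+ w) refl
           (ι (suc n)) (x * E (suc n) x) ((x + x) * ((1# − x) * E′ (suc n) x)) (x * O (suc n) x) ⟩
    _ ∎
    where
    open ≡-Reasoning
    A = scale (ℤ.+ suc n) (mulX (TE (suc n)))
    B = scale (ℤ.+ 2) (mulX (mul1mX (deriv (TE (suc n)))))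
    C = mulX (TO (suc n))

  O-rec : ∀ n x → O (suc (suc n)) x ≡
    ι n * (x * O (suc n) x) + O (suc n) x + (x + x) * ((1# − x) * O′ (suc n) x) + E (suc n) x
  O-rec n x = begin
    O (suc (suc n)) x
      ≡⟨ ev-cong (TO (suc (suc n))) (RHS-O (suc n)) (TO-rec n) x ⟩
    ev (RHS-O (suc n)) x
      ≡⟨ ev-⊕ (A ⊕ TO (suc n)) (B ⊕ TE (suc n)) x ⟩
    ev (A ⊕ TO (suc n)) x + ev (B ⊕ TE (suc n)) x
      ≡⟨ cong₂ _+_
           (trans (ev-⊕ A (TO (suc n)) x) (cong (_+ O (suc n) x) (ev-scale (ℤ.+ n) (mulX (TO (suc n))) x)))
           (trans (ev-⊕ B (TE (suc n)) x) (cong (_+ E (suc n) x) (ev-2x[1-x] (deriv (TO (suc n))) x))) ⟩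
    ι n * (0# + x * O (suc n) x) + O (suc n) x + ((x + x) * ((1# − x) * O′ (suc n) x) + E (suc n) x)
      ≡⟨ solve 5 (λ n u o v w → n :* (:0 :+ u) :+ o :+ (v :+ w) := n :* u :+ o :+ v :+ w) refl
           (ι n) (x * O (suc n) x) (O (suc n) x) ((x + x) * ((1# − x) * O′ (suc n) x)) (E (suc n) x) ⟩
    _ ∎
    where
    open ≡-Reasoning
    A = scale (ℤ.+ n) (mulX (TO (suc n)))
    B = scale (ℤ.+ 2) (mulX (mul1mX (deriv (TO (suc n)))))

  -- The induction.

  -- The induction hypothesis for E and O. Here `c` tells whether n is odd, `es` are the negative
  -- zeros of E in descending order, and O enters only through its signs at the zeros of E. The
  -- derivative is formal, so its form is recorded too.
  record Interlaced (n : ℕ) : Set where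
    field
      c : Bool
      es : List Carrier
      size : n ≡ 𝟙 c ℕ.+ 2 ℕ.* suc (length es)
      desc : Desc (0# ∷ es)
      ℓ : Carrier
      0<ℓ : 0# < ℓ
      E≡ : ∀ x → E n x ≡ ℓ * ∏ (0# ∷ es) x
      E′≡ : ∀ x → E′ n x ≡ ℓ * ∏′ (0# ∷ es) x
      alt : Alt 1# (O n) (0# ∷ es)

    es<0 : All (_< 0#) es
    es<0 with desc
    ... | es<0 ∷ _ = es<0

    es≤0 : All (_≤ 0#) (0# ∷ es)
    es≤0 = ≤-refl ∷ All.map <⇒≤ es<0

  -- The bound allows d above the true degree: with d = deg E, as needed for W, the leading
  -- coefficient is 0 for even n.
  O-lead : ∀ m d → suc m ℕ.≤ 2 ℕ.* suc d → Lead d (O (suc m)) (O′ (suc m)) (ι (#O (suc m) d))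
  O-lead m d bound = subst (Lead d (O (suc m)) (O′ (suc m))) (cong ιᶻ (coeff-TO m d))
    (Lead-ev d (TO (suc m)) λ k d<k → trans (coeff-TO m k)
      (cong ℤ.+_ (#O-vanish m k (ℕ.≤-trans bound (ℕ.*-monoʳ-≤ 2 d<k)))))

  O-at-0 : ∀ m → 0# < 1# * O (suc m) 0#
  O-at-0 m = subst (0# <_) (solve 2 (λ a b → a := :1 :* (a :+ :0 :* b)) refl (ι (#O (suc m) 0)) _)
    (ι-pos (#O-pos m 0 (ℕ.s≤s ℕ.z≤n)))

  -- E = x B formally: B is the tail of the coefficient list, hence a polynomial function also at 0,
  -- where the recurrence gives no value of B.
  record Cofactor (m : ℕ) : Set where
    field
      B B′ : Carrier → Carrier
      value : ∀ x → E (suc m) x ≡ x * B x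
      slope : ∀ x → E′ (suc m) x ≡ B x + x * B′ x
      lead : ∀ d → suc m ℕ.< 2 ℕ.* suc (suc d) → Lead d B B′ (ι (#E (suc m) (suc d)))
      at-0 : B 0# ≡ ι (#E (suc m) 1)

  cofactor : ∀ m → Cofactor m
  cofactor m = record
    { B = ev q ; B′ = ev (deriv q)
    ; value = λ x → trans (cong (λ p → ev p x) TE≡) (CR.+-identityˡ _)
    ; slope = λ x → trans (cong (λ p → ev (deriv p) x) TE≡) (ev-deriv (ℤ.+ 0) q x)
    ; lead = λ d bound → subst (Lead d (ev q) (ev (deriv q))) (cong ιᶻ (coeff-q d))
        (Lead-ev d q λ k d<k → trans (coeff-q k)
          (cong ℤ.+_ (#E-vanish m (suc k) (ℕ.<-≤-trans bound (ℕ.*-monoʳ-≤ 2 (ℕ.s≤s d<k))))))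
    ; at-0 = solve 2 (λ a b → a :+ :0 :* b := a) refl (ι (#E (suc m) 1)) _ }
    where
    q : Poly
    q = map (countLpk isPlus (suc m)) (applyUpTo suc (suc m))
    TE≡ : TE (suc m) ≡ ℤ.+ 0 ∷ q
    TE≡ = cong (λ k → ℤ.+ k ∷ q) (#E-zero m)
    coeff-q : ∀ k → coeff q k ≡ ℤ.+ #E (suc m) (suc k)
    coeff-q k = trans (cong (λ p → coeff p (suc k)) (sym TE≡)) (coeff-TE m (suc k))

  -- T_2^E = x and T_2^O = 1. The zero polynomial T_1^E could not start the induction.
  interlaced-base : Interlaced 2
  interlaced-base = record
    { c = false ; es = [] ; size = refl ; desc = [] ∷ [] ; ℓ = 1# ; 0<ℓ = 0<1
    ; E≡ = λ x → solve 1 (λ x → :0 :+ x :* (:1 :+ :0 :+ x :* (:0 :+ x :* :0)) := :1 :* ((x :- :0) :* :1)) refl x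
    ; E′≡ = λ x → solve 1 (λ x → :1 :+ :0 :+ x :* (:0 :+ x :* :0) := :1 :* (:1 :+ (x :- :0) :* :0)) refl x
    ; alt = O-at-0 1 , tt }

  module Step {m : ℕ} (I : Interlaced (suc m)) where
    open Interlaced I
    open Cofactor (cofactor (suc m)) using (B; B′; at-0; lead) renaming (value to E⁺≡xB; slope to E⁺′≡)

    n = suc m
    d = 𝟙 c ℕ.+ length es

    B-degree : suc n ℕ.< 2 ℕ.* suc (suc d)
    B-degree = subst (λ i → suc i ℕ.< 2 ℕ.* suc (suc d)) (sym size) (bound c (length es))
      where
      bound : ∀ c l → suc (𝟙 c ℕ.+ 2 ℕ.* suc l) ℕ.< 2 ℕ.* suc (suc (𝟙 c ℕ.+ l))
      bound true l rewrite 2*suc (suc (suc l)) | 2*suc (suc l) = ℕ.n≤1+n _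
      bound false l rewrite 2*suc (suc l) = ℕ.≤-refl

    k : Carrier
    k = ι (#E (suc n) (suc d))

    0<k : 0# < k
    0<k = ι-pos (#E-pos m d (subst (λ i → 2 ℕ.* suc d ℕ.≤ suc i) (sym size) (bound c (length es))))
      where
      bound : ∀ c l → 2 ℕ.* suc (𝟙 c ℕ.+ l) ℕ.≤ suc (𝟙 c ℕ.+ 2 ℕ.* suc l)
      bound true l rewrite 2*suc (suc l) = ℕ.≤-refl
      bound false l = ℕ.n≤1+n _

    E-zero : All (λ e → E n e ≡ 0#) (0# ∷ es)
    E-zero = All.map (λ {e} eq → trans (E≡ e) (trans (cong (ℓ *_) eq) (CR.zeroʳ ℓ))) (∏-root (0# ∷ es))

    B-on-es : ∀ {e} → e < 0# × E n e ≡ 0# → B e ≡ (1# + 1#) * ((1# − e) * E′ n e) + O n e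
    B-on-es {e} (e<0 , Ee≡0) = trans (solve 2 (λ b r → b := r :+ (b :- r)) refl (B e) r)
      (trans (cong (r +_) (*-zero-cancel (<⇒≢ e<0) e[B-r]≡0)) (CR.+-identityʳ r))
      where
      r = (1# + 1#) * ((1# − e) * E′ n e) + O n e
      e[B-r]≡0 : e * (B e − r) ≡ 0#
      e[B-r]≡0 = trans (solve 3 (λ e b r → e :* (b :- r) := e :* b :- e :* r) refl e (B e) r)
        (trans (cong (_− e * r) (trans (sym (E⁺≡xB e)) (trans (E-rec m e)
            (cong (λ u → ι n * (e * u) + (e + e) * ((1# − e) * E′ n e) + e * O n e) Ee≡0))))
          (solve 4 (λ n e u o → n :* (e :* :0) :+ (e :+ e) :* u :+ e :* o
              :- e :* ((:1 :+ :1) :* u :+ o) := :0) refl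
            (ι n) e ((1# − e) * E′ n e) (O n e)))

    E′-alt : Alt 1# (E′ n) (0# ∷ es)
    E′-alt = Alt-scale 0<ℓ E′≡ (Alt-∏′ desc)

    B-alt : Alt 1# B (0# ∷ es)
    -- At 0 the factor x cannot be cancelled; B(0) is the coefficient of x in E⁺, positive by
    -- counting.
    B-alt = subst (0# <_) (sym (trans (CR.*-identityˡ _) at-0))
        (ι-pos (#E-pos m 0 (ℕ.s≤s (ℕ.s≤s ℕ.z≤n)))) ,
      Alt-zip (All.zipWith sign (es<0 , All.tail E-zero)) (proj₂ E′-alt) (proj₂ alt)
      where
      sign : ∀ {e} → e < 0# × E n e ≡ 0# → ∀ s → 0# < s * E′ n e → 0# < s * O n e → 0# < s * B e
      sign {e} h@(e<0 , _) s E′-sign O-sign = subst (0# <_)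
        (trans (solve 4 (λ s w u o → w :* (s :* u) :+ s :* o := s :* (w :* u :+ o)) refl s w (E′ n e) (O n e))
          (cong (s *_) (trans (cong (_+ O n e) (CR.*-assoc _ _ _)) (sym (B-on-es h)))))
        (+-pos (*-pos 0<w E′-sign) (<⇒≤ O-sign))
        where
        w = (1# + 1#) * (1# − e)
        0<w : 0# < w
        0<w = *-pos (+-pos 0<1 (<⇒≤ 0<1)) (+-pos 0<1 (<⇒≤ (neg-pos e<0)))

    open Separated (separate c (lead d B-degree) 0<k desc B-alt)
      using (rs; sep; zeros; value; slope) renaming (size to rs-size)

    E-alt : Alt (- 1#) (E n) rs
    E-alt = Alt-scale 0<ℓ E≡ (Alt-∏-Sep desc sep)

    W : Carrier → Carrier
    W x = O n x * E n x + (x + x) * (O′ n x * E n x − O n x * E′ n x)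

    W-nonneg : ∀ {x} → x ≤ 0# → 0# ≤ W x
    W-nonneg {x} x≤0 = subst (0# ≤_)
      (trans (solve 6 (λ l x o o′ p p′ → l :* (o :* p :+ (x :+ x) :* (o′ :* p :- o :* p′))
          := o :* (l :* p) :+ (x :+ x) :* (o′ :* (l :* p) :- o :* (l :* p′))) refl
          ℓ x (O n x) (O′ n x) (∏ (0# ∷ es) x) (∏′ (0# ∷ es) x))
        (cong₂ (λ u v → O n x * u + (x + x) * (O′ n x * u − O n x * v)) (sym (E≡ x)) (sym (E′≡ x))))
      (*-nonneg (<⇒≤ 0<ℓ) (wronskian-nonneg (0# ∷ es) (O-lead m (suc (length es)) degree)
        (ι-nonneg (#O n (suc (length es)))) desc es≤0 alt x x≤0))
      where
      degree : n ℕ.≤ 2 ℕ.* suc (suc (length es))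
      degree = subst (ℕ._≤ 2 ℕ.* suc (suc (length es))) (sym size) (bound c (length es))
        where
        bound : ∀ c l → 𝟙 c ℕ.+ 2 ℕ.* suc l ℕ.≤ 2 ℕ.* suc (suc l)
        bound true l rewrite 2*suc (suc l) = ℕ.n≤1+n _
        bound false l rewrite 2*suc (suc l) = ℕ.m≤n+m _ 2

    -- By the recurrences, E O⁺ equals E² + (1 - x) W - x O² + O E⁺ everywhere, and E⁺ = x B
    -- vanishes here.
    O⁺E-pos : ∀ {x} → x < 0# × B x ≡ 0# × E n x ≢ 0# → 0# < E n x * O (suc n) x
    O⁺E-pos {x} (x<0 , Bx≡0 , Ex≢0) = subst (0# <_) (sym identity)
      (+-pos (square-pos Ex≢0) (+-nonneg (*-nonneg (<⇒≤ (+-pos 0<1 (<⇒≤ (neg-pos x<0)))) (W-nonneg (<⇒≤ x<0)))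
        (*-nonneg (<⇒≤ (neg-pos x<0)) (square-nonneg (O n x)))))
      where
      xB≡0 : ι n * (x * E n x) + (x + x) * ((1# − x) * E′ n x) + x * O n x ≡ 0#
      xB≡0 = trans (sym (E-rec m x)) (trans (E⁺≡xB x) (trans (cong (x *_) Bx≡0) (CR.zeroʳ x)))
      ring : ∀ x m e e′ o o′ →
        e * (m * (x * o) + o + (x + x) * ((1# − x) * o′) + e)
        ≡ e * e + ((1# − x) * (o * e + (x + x) * (o′ * e − o * e′)) + - x * (o * o))
          + o * ((1# + m) * (x * e) + (x + x) * ((1# − x) * e′) + x * o)
      ring = solve 6 (λ x m e e′ o o′ →
        e :* (m :* (x :* o) :+ o :+ (x :+ x) :* ((:1 :- x) :* o′) :+ e)
        := e :* e :+ ((:1 :- x) :* (o :* e :+ (x :+ x) :* (o′ :* e :- o :* e′)) :+ :- x :* (o :* o))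
          :+ o :* ((:1 :+ m) :* (x :* e) :+ (x :+ x) :* ((:1 :- x) :* e′) :+ x :* o)) refl
      identity : E n x * O (suc n) x ≡ E n x * E n x + ((1# − x) * W x + - x * (O n x * O n x))
      identity = trans (cong (E n x *_) (O-rec m x)) (trans (ring x (ι m) (E n x) (E′ n x) (O n x) (O′ n x))
        (trans (cong (λ u → E n x * E n x + ((1# − x) * W x + - x * (O n x * O n x)) + O n x * u) xB≡0)
          (solve 2 (λ a o → a :+ o :* :0 := a) refl _ (O n x))))

    interlaced : Interlaced (suc n)
    interlaced = record
      { c = not c ; es = rs ; size = new-size ; desc = Sep-below sep ∷ Sep-Desc sep
      ; ℓ = k ; 0<ℓ = 0<k
      ; E≡ = λ x → trans (E⁺≡xB x) (trans (cong (x *_) (value x))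
          (solve 3 (λ x k p → x :* (k :* p) := k :* ((x :- :0) :* p)) refl x k (∏ rs x)))
      ; E′≡ = λ x → trans (E⁺′≡ x) (trans (cong₂ (λ u v → u + x * v) (value x) (slope x))
          (solve 4 (λ x k p p′ → k :* p :+ x :* (k :* p′) := k :* (p :+ (x :- :0) :* p′)) refl
            x k (∏ rs x) (∏′ rs x)))
      -- On the zeros of B the signs of E start with - 1, which continues the positive value of O⁺
      -- at 0.
      ; alt = O-at-0 (suc m) , Alt-map
          (All.zipWith (λ h s → same-sign s (O⁺E-pos h)) (Sep-below sep , All.zip (zeros , Alt-≢0 E-alt))) E-alt }
      where
      -- The parity flips, and E gains a zero exactly when n is odd.
      new-size : suc n ≡ 𝟙 (not c) ℕ.+ 2 ℕ.* suc (length rs)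
      new-size = trans (cong suc size) (trans (count c (length es))
          (cong (λ l → 𝟙 (not c) ℕ.+ 2 ℕ.* suc l) (sym rs-size)))
        where
        count : ∀ c l → suc (𝟙 c ℕ.+ 2 ℕ.* suc l) ≡ 𝟙 (not c) ℕ.+ 2 ℕ.* suc (𝟙 c ℕ.+ l)
        count true l = sym (2*suc (suc l))
        count false l = refl

  all-interlaced : ∀ m → Interlaced (suc (suc m))
  all-interlaced zero = interlaced-base
  all-interlaced (suc m) = Step.interlaced (all-interlaced m)

  -- Ascending lists of zeros and the interlacing relation.

  -- A′ and B hold, in ascending order, the elements already traversed; p is the current one.
  record Reversed (p : Carrier) (ps rs A′ B : List Carrier) : Set where
    field
      θ ξ : List Carrier
      θ-sorted : Sorted R θ
      ξ-sorted : Sorted R ξ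
      θ-∏ : ∀ x → ∏ θ x ≡ ∏ (p ∷ A′) x * ∏ ps x
      ξ-∏ : ∀ x → ∏ ξ x ≡ ∏ B x * ∏ rs x
      θ≤0 : All (_≤ 0#) θ
      ξ≤0 : All (_≤ 0#) ξ
      alternating : (length θ ≡ suc (length ξ) × Sorted R (interleave R θ ξ)) ⊎
        (length ξ ≡ length θ × Sorted R (interleave R ξ θ))

  lower-head : ∀ {p q xs} → q ≤ p → Sorted R (p ∷ xs) → Sorted R (q ∷ xs)
  lower-head q≤p [-] = [-]
  lower-head q≤p (p≤x ∷ xs) = ≤-trans q≤p p≤x ∷ xs

  -- Reversal with accumulators. The two ends of a chain are the two cases of ≺: `done` gives E one
  -- more zero than O, `extra` gives equally many, the lowest belonging to O.
  reverse-Sep : ∀ {p ps rs} → Sep p ps rs → ∀ A′ B → Sorted R (p ∷ A′) → Sorted R (p ∷ B) →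
    length A′ ≡ length B → Sorted R (interleave R (p ∷ A′) B) →
    p ≤ 0# → All (_≤ 0#) A′ → All (_≤ 0#) B → Reversed p ps rs A′ B
  reverse-Sep {p} done A′ B A-sorted B-sorted len mixed p≤0 A≤0 B≤0 = record
    { θ = p ∷ A′ ; ξ = B ; θ-sorted = A-sorted ; ξ-sorted = Linked.tail B-sorted
    ; θ-∏ = λ x → sym (CR.*-identityʳ _) ; ξ-∏ = λ x → sym (CR.*-identityʳ _)
    ; θ≤0 = p≤0 ∷ A≤0 ; ξ≤0 = B≤0 ; alternating = inj₁ (cong suc len , mixed) }
  reverse-Sep {p} (extra {r = r} r<p) A′ B A-sorted B-sorted len mixed p≤0 A≤0 B≤0 = record
    { θ = p ∷ A′ ; ξ = r ∷ B ; θ-sorted = A-sorted ; ξ-sorted = lower-head (<⇒≤ r<p) B-sorted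
    ; θ-∏ = λ x → sym (CR.*-identityʳ _)
    ; ξ-∏ = λ x → solve 2 (λ a b → a :* b := b :* (a :* :1)) refl (x − r) (∏ B x)
    ; θ≤0 = p≤0 ∷ A≤0 ; ξ≤0 = ≤-trans (<⇒≤ r<p) p≤0 ∷ B≤0
    ; alternating = inj₂ (cong suc (sym len) , <⇒≤ r<p ∷ mixed) }
  reverse-Sep {p} {q ∷ ps} {r ∷ rs} (next q<r r<p sep) A′ B A-sorted B-sorted len mixed p≤0 A≤0 B≤0 = record
    { θ = θ ; ξ = ξ ; θ-sorted = θ-sorted ; ξ-sorted = ξ-sorted
    ; θ-∏ = λ x → trans (θ-∏ x)
        (solve 3 (λ a b c → a :* b :* c := b :* (a :* c)) refl (x − q) (∏ (p ∷ A′) x) (∏ ps x))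
    ; ξ-∏ = λ x → trans (ξ-∏ x)
        (solve 3 (λ a b c → a :* b :* c := b :* (a :* c)) refl (x − r) (∏ B x) (∏ rs x))
    ; θ≤0 = θ≤0 ; ξ≤0 = ξ≤0 ; alternating = alternating }
    where
    q≤p = <⇒≤ (<-trans q<r r<p)
    open Reversed (reverse-Sep sep (p ∷ A′) (r ∷ B) (q≤p ∷ A-sorted)
      (<⇒≤ q<r ∷ lower-head (<⇒≤ r<p) B-sorted) (cong suc len) (<⇒≤ q<r ∷ <⇒≤ r<p ∷ mixed)
      (≤-trans q≤p p≤0) (p≤0 ∷ A≤0) (≤-trans (<⇒≤ r<p) p≤0 ∷ B≤0))

  real-rooted : ∀ m → let n = suc (suc m) in
    OnlyRealNonPosZeros R (TE n) × OnlyRealNonPosZeros R (TO n) × Interlaces R (TO n) (TE n)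
  real-rooted m = (θ , E-zeros , θ≤0) , (ξ , O-zeros , ξ≤0) , (ξ , θ , O-zeros , E-zeros , alternating)
    where
    n = suc (suc m)
    open Interlaced (all-interlaced m)
    d = 𝟙 c ℕ.+ length es

    O-degree : n ℕ.≤ 2 ℕ.* suc d
    O-degree = subst (ℕ._≤ 2 ℕ.* suc d) (sym size) (bound c (length es))
      where
      bound : ∀ c l → 𝟙 c ℕ.+ 2 ℕ.* suc l ℕ.≤ 2 ℕ.* suc (𝟙 c ℕ.+ l)
      bound true l rewrite 2*suc (suc l) = ℕ.n≤1+n _
      bound false l = ℕ.≤-refl

    0<k : 0# < ι (#O n d)
    0<k = ι-pos (#O-pos (suc m) d (subst (2 ℕ.* d ℕ.<_) (sym size) (bound c (length es))))
      where
      bound : ∀ c l → 2 ℕ.* (𝟙 c ℕ.+ l) ℕ.< 𝟙 c ℕ.+ 2 ℕ.* suc l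
      bound true l = ℕ.≤-refl
      bound false l rewrite 2*suc l = ℕ.n≤1+n _

    -- The zeros of O lie in the gaps between those of E, and for odd n one more lies below them
    -- all.
    open Separated (separate c (O-lead (suc m) d O-degree) 0<k desc alt) using (rs; sep; value)
    open Reversed (reverse-Sep sep [] [] [-] [-] refl [-] ≤-refl [] [])

    E-zeros : ZerosOf R (TE n) θ
    E-zeros = θ-sorted , ℓ , pos⇒≢0 0<ℓ , λ x → trans (E≡ x) (cong (ℓ *_)
      (trans (solve 2 (λ a b → a :* b := a :* :1 :* b) refl (x − 0#) (∏ es x)) (sym (θ-∏ x))))

    O-zeros : ZerosOf R (TO n) ξ
    O-zeros = ξ-sorted , ι (#O n d) , pos⇒≢0 0<k , λ x → trans (value x) (cong (ι (#O n d) *_)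
      (trans (sym (CR.*-identityˡ _)) (sym (ξ-∏ x))))

open Recurrences using (TE-rec; TO-rec)
open import Data.Nat using (_≤_)
open import Data.Integer using (+_)

theorem2p10 : ((n : ℕ) → 1 ≤ n → (TE (suc n) ≈ₚ RHS-E n) × (TO (suc n) ≈ₚ RHS-O n))
    × (TE 1 ≈ₚ []) × (TO 1 ≈ₚ (+ 1 ∷ []))
    × ((R : RealField) → (n : ℕ) → 2 ≤ n →
    OnlyRealNonPosZeros R (TE n) × OnlyRealNonPosZeros R (TO n)
    × Interlaces R (TO n) (TE n))
theorem2p10 =
  (λ { (suc n) _ → TE-rec n , TO-rec n }) ,
  (λ { 0 → refl ; 1 → refl ; (suc (suc _)) → refl }) ,
  (λ { 0 → refl ; 1 → refl ; (suc (suc _)) → refl }) ,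
  λ { R (suc (suc m)) (ℕ.s≤s (ℕ.s≤s _)) → RealRootedness.real-rooted R m }
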